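{- Let $b=(b_1,b_2)$ be integers with $2\le b_1\le b_2$ and $\gcd(b_1,b_2)=1$. Let $\tau=b_2 \bmod b_1$, let $i^*\in\{1,\ldots,b_1-1\}$ be such that $\tau\cdot i^*\equiv b_1-1 \pmod{b_1}$, and let $x=(i^*,\lceil b_2 i^*/b_1\rceil)$. Then the $2$-partition $(x,b-x)$ of $b$ solves the problem of Partition of Maximin Diversity for $b$ with two parts, i.e. it maximizes $\min\{D(x_1),D(x_2)\}$ over all pairs $x_1,x_2\in\mathbb{Z}_+^2\setminus\{0\}$ with $x_1+x_2=b$. Moreover, computing $(x,b-x)$ from $b$ in this way takes time $\mathcal{O}(\log^2\max\{b_1,b_2\})$.
   Context: $\mathbb{Z}_+^2$ denotes the pairs of non-negative integers. For nonzero $x\in\mathbb{Z}_+^2$, the diversity (Simpson dominance index) is $D(x)=\|x\|_1^2/\|x\|_2^2$. The problem of Partition of Maximin Diversity with two parts asks for the minimum $\varepsilon(b,2)=\varepsilon\ge 0$ such that there are nonzero $x_1,x_2\in\mathbb{Z}_+^2$ with $x_1+x_2=b$ and $D(x_i)\ge(1-\varepsilon)D(b)$ for $i=1,2$; a $2$-partition solves it if it attains this minimum, equivalently if it maximizes $\min\{D(x_1),D(x_2)\}$. The number $i^*$ is computed with the Extended Euclidean algorithm, and the running time counts the cost of arithmetic on integers in terms of their bit length. -}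

module Defs where

open import Data.Bool.Base using (Bool; if_then_else_)
open import Data.Empty using (⊥)
open import Data.Integer.Base as ℤ using (ℤ; -[1+_]; ∣_∣; sign; _◃_; 0ℤ; 1ℤ)
open import Data.Nat.Base using
  (ℕ; zero; suc; _+_; _*_; _∸_; _^_; _%_; _≤_; _<ᵇ_; _≡ᵇ_; ⌊_/2⌋; NonZero)
open import Data.Nat.Logarithm using (⌊log₂_⌋)
open import Data.Nat.Properties using (m+n≡0⇒m≡0)
open import Data.Product.Base using (_×_; _,_; proj₁; proj₂; Σ-syntax; ∃-syntax)
open import Data.Rational.Base as ℚ using (ℚ; 0ℚ; 1ℚ; ceiling)
open import Relation.Binary.PropositionalEquality using (_≡_; _≢_; refl; cong; cong₂; trans)

ℤ₊² : Set
ℤ₊² = ℕ × ℕ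

𝟎 : ℤ₊²
𝟎 = 0 , 0

infixl 6 _⊕_ _⊖_

_⊕_ : ℤ₊² → ℤ₊² → ℤ₊²
(x₁ , x₂) ⊕ (y₁ , y₂) = (x₁ + y₁ , x₂ + y₂)

-- Truncated at 0 in each coordinate; `IsPartition b x (b ⊖ x)` holds
-- only if no truncation takes place.
_⊖_ : ℤ₊² → ℤ₊² → ℤ₊²
(x₁ , x₂) ⊖ (y₁ , y₂) = (x₁ ∸ y₁ , x₂ ∸ y₂)

‖_‖₁ : ℤ₊² → ℕ
‖ x₁ , x₂ ‖₁ = x₁ + x₂

‖_‖₂² : ℤ₊² → ℕ
‖ x₁ , x₂ ‖₂² = x₁ ^ 2 + x₂ ^ 2

‖‖₂²-nonZero : ∀ x → .(x ≢ 𝟎) → NonZero ‖ x ‖₂²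
‖‖₂²-nonZero (suc _ , _)     _   = _
‖‖₂²-nonZero (zero  , suc _) _   = _
‖‖₂²-nonZero (zero  , zero)  x≢𝟎 = bot (x≢𝟎 refl)
  where
  bot : .⊥ → NonZero 0
  bot ()

D : (x : ℤ₊²) → .(x ≢ 𝟎) → ℚ
D x x≢𝟎 = ((ℤ.+ (‖ x ‖₁ ^ 2)) ℚ./ ‖ x ‖₂²) {{‖‖₂²-nonZero x x≢𝟎}}

record IsPartition (b x₁ x₂ : ℤ₊²) : Set where
  field
    x₁≢𝟎 : x₁ ≢ 𝟎
    x₂≢𝟎 : x₂ ≢ 𝟎
    sum≡ : x₁ ⊕ x₂ ≡ b

  b≢𝟎 : b ≢ 𝟎
  b≢𝟎 b≡𝟎 = x₁≢𝟎 (cong₂ _,_ (m+n≡0⇒m≡0 _ (cong proj₁ eq)) (m+n≡0⇒m≡0 _ (cong proj₂ eq)))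
    where
    eq : x₁ ⊕ x₂ ≡ 𝟎
    eq = trans sum≡ b≡𝟎

Feasible : (b : ℤ₊²) (ε : ℚ) (x₁ x₂ : ℤ₊²) → Set
Feasible b ε x₁ x₂ = Σ[ p ∈ IsPartition b x₁ x₂ ] let open IsPartition p in
  ((1ℚ ℚ.- ε) ℚ.* D b b≢𝟎 ℚ.≤ D x₁ x₁≢𝟎) ×
  ((1ℚ ℚ.- ε) ℚ.* D b b≢𝟎 ℚ.≤ D x₂ x₂≢𝟎)

Attainable : ℤ₊² → ℚ → Set
Attainable b ε = (0ℚ ℚ.≤ ε) × (∃[ x₁ ] ∃[ x₂ ] Feasible b ε x₁ x₂)

-- ε is the number ε(b,2).  There are finitely many partitions and D is
-- rational-valued, so the minimum over real ε is the one over rational ε.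
IsMinimumε : ℤ₊² → ℚ → Set
IsMinimumε b ε = Attainable b ε × (∀ ε′ → Attainable b ε′ → ε ℚ.≤ ε′)

Solves : (b x₁ x₂ : ℤ₊²) → Set
Solves b x₁ x₂ = ∃[ ε ] (IsMinimumε b ε × Feasible b ε x₁ x₂)

minD : ∀ {b x₁ x₂} → IsPartition b x₁ x₂ → ℚ
minD {b} {x₁} {x₂} p = D x₁ x₁≢𝟎 ℚ.⊓ D x₂ x₂≢𝟎
  where open IsPartition p

MaximizesMinD : (b x₁ x₂ : ℤ₊²) → Set
MaximizesMinD b x₁ x₂ = Σ[ p ∈ IsPartition b x₁ x₂ ]
  (∀ {y₁ y₂} (q : IsPartition b y₁ y₂) → minD q ℚ.≤ minD p)

Isi* : (b₁ b₂ : ℕ) .{{_ : NonZero b₁}} → ℕ → Set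
Isi* b₁ b₂ i = (1 ≤ i) × (i ≤ b₁ ∸ 1) × ((τ * i) % b₁ ≡ (b₁ ∸ 1) % b₁)
  where
  τ : ℕ
  τ = b₂ % b₁

part : (b₁ b₂ : ℕ) .{{_ : NonZero b₁}} → ℕ → ℤ₊²
part b₁ b₂ i = i , ∣ ceiling ((ℤ.+ (b₂ * i)) ℚ./ b₁) ∣

-- Computations with a count of bit operations.  The programs below touch
-- numbers only through the primitives add, sub, subℤ, lessThan and halve,
-- each charged the total bit length of its operands, and through reading or
-- setting a sign, which is free.  Multiplication, division and the Euclidean
-- algorithm are programs over these, so their costs are derived.
record Timed (A : Set) : Set where
  constructor timed
  field
    value : A
    cost  : ℕ

open Timed public

return : ∀ {A} → A → Timed A
return x = timed x 0

infixl 1 _>>=_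

_>>=_ : ∀ {A B} → Timed A → (A → Timed B) → Timed B
m >>= f = timed (value (f (value m))) (cost m + cost (f (value m)))

-- ⌊log₂ 0 ⌋ is 0, so 0 has bit length 1 and no primitive is free.
bits : ℕ → ℕ
bits n = suc ⌊log₂ n ⌋

add : ℕ → ℕ → Timed ℕ
add m n = timed (m + n) (bits m + bits n)

sub : ℕ → ℕ → Timed ℕ
sub m n = timed (m ∸ n) (bits m + bits n)

subℤ : ℤ → ℤ → Timed ℤ
subℤ s t = timed (s ℤ.- t) (bits ∣ s ∣ + bits ∣ t ∣)

lessThan : ℕ → ℕ → Timed Bool
lessThan m n = timed (m <ᵇ n) (bits m + bits n)

-- Right shift, with the bit shifted out.
halve : ℕ → Timed (ℕ × Bool)
halve n = timed (⌊ n /2⌋ , (n % 2 ≡ᵇ 1)) (bits n)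

-- The first argument of mul′, divMod′ and egcd′ only bounds the recursion
-- depth; the initial values chosen below suffice (for divMod, when b > 0).

mul′ : ℕ → ℕ → ℕ → Timed ℕ
mul′ zero    m n = return 0
mul′ (suc k) m n = do
  m≡0 ← lessThan m 1
  if m≡0 then return 0 else do
    (h , odd) ← halve m
    p  ← mul′ k h n
    2p ← add p p
    if odd then add 2p n else return 2p

mul : ℕ → ℕ → Timed ℕ
mul m n = mul′ m m n

-- Long division: quotient and remainder by 2b are refined to those by b.
divMod′ : ℕ → ℕ → ℕ → Timed (ℕ × ℕ)
divMod′ zero    a b = return (0 , a)
divMod′ (suc k) a b = do
  a<b ← lessThan a b
  if a<b then return (0 , a) else do
    2b      ← add b b
    (q , r) ← divMod′ k a 2b
    2q      ← add q q
    r<b     ← lessThan r b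
    if r<b then return (2q , r) else do
      q′ ← add 2q 1
      r′ ← sub r b
      return (q′ , r′)

divMod : ℕ → ℕ → Timed (ℕ × ℕ)
divMod a b = divMod′ a a b

-- Extended Euclidean algorithm: (s , t) with s·a + t·b = gcd a b.
egcd′ : ℕ → ℕ → ℕ → Timed (ℤ × ℤ)
egcd′ zero    a b = return (1ℤ , 0ℤ)
egcd′ (suc k) a b = do
  b≡0 ← lessThan b 1
  if b≡0 then return (1ℤ , 0ℤ) else do
    (q , r) ← divMod a b
    (s , t) ← egcd′ k b r
    u       ← mul q ∣ t ∣
    t′      ← subℤ s (sign t ◃ u)
    return (t , t′)

egcd : ℕ → ℕ → Timed (ℤ × ℤ)
egcd a b = egcd′ (suc b) a b

-- The residue of - t modulo m, for 0 < ∣ t ∣ < m.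
negMod : ℤ → ℕ → Timed ℕ
negMod (ℤ.+ n)    m = sub m n
negMod -[1+ n ] m = return (suc n)

ceilDiv : ℕ → ℕ → Timed ℕ
ceilDiv a b = do
  (q , r) ← divMod a b
  r≡0     ← lessThan r 1
  if r≡0 then return q else add q 1

computei* : ℕ → ℕ → Timed ℕ
computei* b₁ b₂ = do
  (_ , τ) ← divMod b₂ b₁
  (_ , t) ← egcd b₁ τ
  negMod t b₁

computePartition : ℤ₊² → Timed (ℤ₊² × ℤ₊²)
computePartition (b₁ , b₂) = do
  i  ← computei* b₁ b₂
  p  ← mul b₂ i
  c  ← ceilDiv p b₁
  y₁ ← sub b₁ i
  y₂ ← sub b₂ c
  return ((i , c) , (y₁ , y₂))

{-# OPTIONS --safe #-}
-- Write det (x , y) = x₁y₂ - y₁x₂.  The congruence for i* says det (b , x) = 1,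
-- so x is the part above the line through b, b - x is the part below it, and
-- both lie above the diagonal, where D decreases as the slope grows; hence
-- min D is D(x).  In any partition one part y has det (b , y) ≥ 1, as gcd b₁ b₂ = 1
-- excludes proper multiples on the line through b; because det (b , x) = 1, such a y
-- is at least as steep as x and D(y) ≤ D(x).
-- For the running time, one step of the Euclidean algorithm on (a , b) costs
-- O((1 + log (a / b)) log a), and the factors 1 + log (a / b) telescope.
module Submission where

open import Data.Bool.Base using (true; false; if_then_else_)
open import Data.Empty using (⊥-elim-irr)
open import Data.Integer.Base as ℤ using (ℤ; ∣_∣; sign; _◃_; 0ℤ; 1ℤ)
import Data.Integer.Divisibility.Signed as ℤ
import Data.Integer.DivMod as ℤ
import Data.Integer.Properties as ℤ
import Data.Integer.Tactic.RingSolver as ℤ-Solver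
open import Data.Nat.Base
open import Data.Nat.Coprimality as Coprime using (Coprime; coprime-divisor; gcd≡1⇒coprime)
open import Data.Nat.Divisibility
open import Data.Nat.DivMod
open import Data.Nat.GCD using (gcd; gcd[m,n]≢0)
open import Data.Nat.Logarithm
open import Data.Nat.Properties
open import Data.Nat.Tactic.RingSolver using (solve-∀)
open import Data.Product.Base using (_×_; _,_; proj₁; proj₂; Σ-syntax; ∃-syntax)
open import Data.Rational.Base as ℚ using (ℚ; 0ℚ; 1ℚ; 1/_; ↥_; ↧_; floor; ceiling)
import Data.Rational.Properties as ℚ
import Data.Rational.Solver as ℚ-Solver
open import Data.Rational.Unnormalised.Base using (mkℚᵘ; *≤*)
import Data.Rational.Unnormalised.Properties as ℚᵘ
open import Data.Sum.Base using (inj₁; inj₂)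
open import Relation.Binary.Definitions using (tri<; tri≈; tri>)
open import Relation.Binary.PropositionalEquality
  using (_≡_; _≢_; refl; sym; trans; cong; cong₂; subst; module ≡-Reasoning)
open import Relation.Nullary using (yes; no; contradiction)
open import Relation.Nullary.Reflects using (ofʸ; ofⁿ)
open import Defs

-- Multiplication and division

private
  variable
    A : Set

bits-mono-≤ : ∀ {m n} → m ≤ n → bits m ≤ bits n
bits-mono-≤ m≤n = s≤s (⌊log₂⌋-mono-≤ m≤n)

bits-double : ∀ n → bits (n + n) ≤ suc (bits n)
bits-double zero = s≤s z≤n
bits-double n@(suc _) = ≤-reflexive (cong suc (trans
  (cong (λ m → ⌊log₂ n + m ⌋) (sym (+-identityʳ n)))
  (⌊log₂[2*b]⌋≡1+⌊log₂b⌋ n)))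

cost-if : ∀ c {t e : Timed A} {n} → cost t ≤ n → cost e ≤ n → cost (if c then t else e) ≤ n
cost-if true  t≤n _   = t≤n
cost-if false _   e≤n = e≤n

-- Remainder and half of `suc (suc n)` reduce to those of `n`, hence the induction in steps of two.
-- This is what makes the recursion of `mul′` on the half correct.
halves-sum : ∀ n → (if n % 2 ≡ᵇ 1 then suc (⌊ n /2⌋ + ⌊ n /2⌋) else ⌊ n /2⌋ + ⌊ n /2⌋) ≡ n
halves-sum zero          = refl
halves-sum (suc zero)    = refl
halves-sum (suc (suc n)) =
  trans (shift (n % 2 ≡ᵇ 1) ⌊ n /2⌋) (cong (2 +_) (halves-sum n))
  where
  shift : ∀ c h → (if c then suc (suc h + suc h) else suc h + suc h)
                ≡ 2 + (if c then suc (h + h) else h + h)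
  shift true  h = cong (2 +_) (+-suc h h)
  shift false h = cong suc (+-suc h h)

mul′-value : ∀ k m n → m ≤ k → value (mul′ k m n) ≡ m * n
mul′-value zero    zero      n _ = refl
mul′-value (suc k) zero      n _ = refl
mul′-value (suc k) m@(suc l) n (s≤s l≤k)
  rewrite mul′-value k ⌊ m /2⌋ n (≤-trans (s≤s⁻¹ (⌊n/2⌋<n l)) l≤k) =
  trans (collect (m % 2 ≡ᵇ 1) ⌊ m /2⌋) (cong (_* n) (halves-sum m))
  where
  collect : ∀ c h → value (if c then add (h * n + h * n) n else return (h * n + h * n))
                  ≡ (if c then suc (h + h) else h + h) * n
  collect true  h = lemma h n where
    lemma : ∀ h n → h * n + h * n + n ≡ suc (h + h) * n
    lemma = solve-∀
  collect false h = sym (*-distribʳ-+ n h h)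

mul-value : ∀ m n → value (mul m n) ≡ m * n
mul-value m n = mul′-value m m n ≤-refl

⌊n/2⌋+⌊n/2⌋≤n : ∀ n → ⌊ n /2⌋ + ⌊ n /2⌋ ≤ n
⌊n/2⌋+⌊n/2⌋≤n n = ≤-trans (+-monoʳ-≤ ⌊ n /2⌋ (⌊n/2⌋≤⌈n/2⌉ n)) (≤-reflexive (⌊n/2⌋+⌈n/2⌉≡n n))

double-cancel-< : ∀ m n → m + m < n + n → m < n
double-cancel-< m n 2m<2n with m <? n
... | yes m<n = m<n
... | no  m≮n = contradiction 2m<2n (≤⇒≯ (+-mono-≤ (≮⇒≥ m≮n) (≮⇒≥ m≮n)))

-- Each round removes a bit of `m`, so `j` counts the rounds, while `k` only has to be large enough.
-- Intermediate products never exceed `m * n ≤ M`, so in units of `bits M` a round costs at most 7: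
-- 2 for the test, 1 for the halving, 4 for the additions. The summand 2 pays for the final test at
-- `m = 0`.
mul′-cost : ∀ k m n M j → m ≤ k → m < 2 ^ j → m ≤ M → n ≤ M → m * n ≤ M →
            cost (mul′ k m n) ≤ 2 + j * (7 * bits M)
mul′-cost zero    m         n M j _ _ _ _ _ = z≤n
mul′-cost (suc k) zero      n M j _ _ _ _ _ = m≤m+n 2 _
mul′-cost (suc k) m@(suc l) n M zero _ (s≤s ()) _ _ _
mul′-cost (suc k) m@(suc l) n M (suc j) (s≤s l≤k) m<2^j m≤M n≤M mn≤M
  rewrite mul′-value k ⌊ m /2⌋ n (≤-trans (s≤s⁻¹ (⌊n/2⌋<n l)) l≤k) = begin
  _ ≤⟨ +-mono-≤ (+-mono-≤ bm 1≤N) (+-mono-≤ bm (+-mono-≤ rec (+-mono-≤ (+-mono-≤ bp bp)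
         (cost-if (m % 2 ≡ᵇ 1) {add (p + p) n} {return (p + p)} (+-mono-≤ b2p (bits-mono-≤ n≤M)) z≤n)))) ⟩
  _ ≡⟨ lemma j (bits M) ⟩
  2 + suc j * (7 * bits M) ∎
  where
  open ≤-Reasoning
  h = ⌊ m /2⌋
  p = h * n
  h≤m : h ≤ m
  h≤m = ⌊n/2⌋≤n m
  2p≤M : p + p ≤ M
  2p≤M = ≤-trans (≤-reflexive (sym (*-distribʳ-+ n h h))) (≤-trans (*-monoˡ-≤ n (⌊n/2⌋+⌊n/2⌋≤n m)) mn≤M)
  bm = bits-mono-≤ m≤M
  b2p = bits-mono-≤ 2p≤M
  bp = bits-mono-≤ (≤-trans (m≤m+n p p) 2p≤M)
  1≤N : 1 ≤ bits M
  1≤N = s≤s z≤n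
  rec = mul′-cost k h n M j (≤-trans (s≤s⁻¹ (⌊n/2⌋<n l)) l≤k)
          (double-cancel-< h (2 ^ j) (≤-<-trans (⌊n/2⌋+⌊n/2⌋≤n m) (<-≤-trans m<2^j
             (≤-reflexive (cong (2 ^ j +_) (+-identityʳ (2 ^ j)))))))
          (≤-trans h≤m m≤M) n≤M (≤-trans (m≤m+n p p) 2p≤M)
  lemma : ∀ j N → N + N + (N + ((2 + j * (7 * N)) + (N + N + (N + N)))) ≡ 2 + suc j * (7 * N)
  lemma = solve-∀

mul-cost : ∀ m n M j → m < 2 ^ j → m ≤ M → n ≤ M → m * n ≤ M → cost (mul m n) ≤ 2 + j * (7 * bits M)
mul-cost m n M j = mul′-cost m m n M j ≤-refl

-- The pair `(0 , a)` satisfies the identity even when the recursion depth is exhausted, so `k` is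
-- arbitrary; depth matters only for the size of the remainder.
divMod′-sum : ∀ k a b → let (q , r) = value (divMod′ k a b) in q * b + r ≡ a
divMod′-sum zero    a b = refl
divMod′-sum (suc k) a b with a <ᵇ b
... | true  = refl
... | false with value (divMod′ k a (b + b)) | divMod′-sum k a (b + b)
...   | q , r | eq with r <ᵇ b | <ᵇ-reflects-< r b
...     | true  | _       = trans (lemma q b r) eq
  where
  lemma : ∀ q b r → (q + q) * b + r ≡ q * (b + b) + r
  lemma = solve-∀
...     | false | ofⁿ r≮b = trans (lemma q b (r ∸ b)) (trans (cong (q * (b + b) +_) (m∸n+n≡m (≮⇒≥ r≮b))) eq)
  where
  lemma : ∀ q b s → (q + q + 1) * b + s ≡ q * (b + b) + (s + b)
  lemma = solve-∀

2^-suc-* : ∀ k b → 2 ^ suc k * b ≡ 2 ^ k * (b + b)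
2^-suc-* k b = lemma (2 ^ k) b
  where
  lemma : ∀ x b → 2 * x * b ≡ x * (b + b)
  lemma = solve-∀

-- Each level doubles the divisor and uses up one factor 2 of the bound, so at depth 0 the dividend
-- is already below the divisor.
divMod′-rem : ∀ k a b → a < 2 ^ k * b → proj₂ (value (divMod′ k a b)) < b
divMod′-rem zero    a b a<b = <-≤-trans a<b (≤-reflexive (+-identityʳ b))
divMod′-rem (suc k) a b a<2^kb with a <ᵇ b | <ᵇ-reflects-< a b
... | true  | ofʸ a<b = a<b
... | false | _ with value (divMod′ k a (b + b))
                   | divMod′-rem k a (b + b) (<-≤-trans a<2^kb (≤-reflexive (2^-suc-* k b)))
...   | q , r | r<2b with r <ᵇ b | <ᵇ-reflects-< r b
...     | true  | ofʸ r<b = r<b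
...     | false | ofⁿ r≮b = +-cancelʳ-< b (r ∸ b) b (≤-<-trans (≤-reflexive (m∸n+n≡m (≮⇒≥ r≮b))) r<2b)

n<2^n : ∀ n → n < 2 ^ n
n<2^n zero = s≤s z≤n
n<2^n (suc n) = ≤-trans (+-mono-≤ (≤-trans (s≤s z≤n) (n<2^n n)) (n<2^n n))
  (≤-reflexive (cong (2 ^ n +_) (sym (+-identityʳ (2 ^ n)))))

divMod-sum : ∀ a b → let (q , r) = value (divMod a b) in q * b + r ≡ a
divMod-sum a b = divMod′-sum a a b

divMod-rem : ∀ a b → 1 ≤ b → proj₂ (value (divMod a b)) < b
-- Depth `a` suffices because `a < 2 ^ a`.
divMod-rem a b 1≤b = divMod′-rem a a b (<-≤-trans (n<2^n a)
  (≤-trans (≤-reflexive (sym (*-identityʳ _))) (*-monoʳ-≤ (2 ^ a) 1≤b)))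

-- `j` bounds the doublings that take the divisor beyond `a`. The last divisor may exceed `a`, but
-- it is twice one that does not, hence the bound `M + M`. That last call costs at most
-- `3 * bits M`; every other round costs at most `12 * bits M`, and 13 leaves some slack.
divMod′-cost : ∀ k a b M j → 1 ≤ b → a ≤ M → b ≤ M + M → a < 2 ^ j * b →
               cost (divMod′ k a b) ≤ 3 * bits M + j * (13 * bits M)
divMod′-cost zero    a b M j _ _ _ _ = z≤n
divMod′-cost (suc k) a b M j 1≤b a≤M b≤2M a<2^jb with a <ᵇ b | <ᵇ-reflects-< a b
... | true  | _ =
  ≤-trans (+-mono-≤ (+-mono-≤ (bits-mono-≤ a≤M) (≤-trans (bits-mono-≤ b≤2M) (bits-double M))) z≤n)
          (≤-trans (lemma (bits M) (s≤s z≤n)) (m≤m+n _ _))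
  where
  lemma : ∀ N → 1 ≤ N → (N + suc N) + 0 ≤ 3 * N
  lemma N 1≤N = ≤-trans (≤-reflexive (e₁ N)) (≤-trans (+-monoˡ-≤ (N + N) 1≤N) (≤-reflexive (e₂ N)))
    where
    e₁ : ∀ N → (N + suc N) + 0 ≡ 1 + (N + N)
    e₁ = solve-∀
    e₂ : ∀ N → N + (N + N) ≡ 3 * N
    e₂ = solve-∀
divMod′-cost (suc k) a b M zero 1≤b a≤M b≤2M a<2^jb | false | ofⁿ a≮b =
  contradiction (<-≤-trans a<2^jb (≤-reflexive (+-identityʳ b))) a≮b
divMod′-cost (suc k) a b M (suc j) 1≤b a≤M b≤2M a<2^jb | false | ofⁿ a≮b = begin
  _ ≤⟨ +-mono-≤ (+-mono-≤ ba bb) (+-mono-≤ (+-mono-≤ bb bb) (+-mono-≤ rec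
        (+-mono-≤ (+-mono-≤ bq bq) (+-mono-≤ (+-mono-≤ br bb)
          (cost-if (r <ᵇ b) {return (q + q , r)}
                   {add (q + q) 1 >>= λ q′ → sub r b >>= λ r′ → return (q′ , r′)} z≤n
             (+-mono-≤ (+-mono-≤ b2q (s≤s z≤n)) (+-mono-≤ (+-mono-≤ br bb) z≤n))))))) ⟩
  _ ≤⟨ lemma j N ⟩
  3 * N + suc j * (13 * N) ∎
  where
  open ≤-Reasoning
  N = bits M
  rec = divMod′-cost k a (b + b) M j (≤-trans 1≤b (m≤m+n b b)) a≤M
          (+-mono-≤ (≤-trans (≮⇒≥ a≮b) a≤M) (≤-trans (≮⇒≥ a≮b) a≤M))
          (<-≤-trans a<2^jb (≤-reflexive (2^-suc-* j b)))
  q = proj₁ (value (divMod′ k a (b + b)))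
  r = proj₂ (value (divMod′ k a (b + b)))
  qr = divMod′-sum k a (b + b)
  b≤M = ≤-trans (≮⇒≥ a≮b) a≤M
  ba = bits-mono-≤ a≤M
  bb = bits-mono-≤ b≤M
  r≤M = ≤-trans (m≤n+m r (q * (b + b))) (≤-trans (≤-reflexive qr) a≤M)
  br = bits-mono-≤ r≤M
  2q≤M = ≤-trans (≤-trans (≤-reflexive (sym (*-identityʳ (q + q)))) (*-monoʳ-≤ (q + q) 1≤b))
           (≤-trans (≤-reflexive (e q b)) (≤-trans (m≤m+n _ r) (≤-trans (≤-reflexive qr) a≤M)))
    where
    e : ∀ q b → (q + q) * b ≡ q * (b + b)
    e = solve-∀
  b2q = bits-mono-≤ 2q≤M
  bq = bits-mono-≤ (≤-trans (m≤m+n q q) 2q≤M)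
  lemma : ∀ j N → N + N + (N + N + ((3 * N + j * (13 * N)) + (N + N + (N + N + (N + N + (N + N + 0))))))
        ≤ 3 * N + suc j * (13 * N)
  lemma j N = ≤-trans (m≤m+n _ N) (≤-reflexive (e j N))
    where
    e : ∀ j N → N + N + (N + N + ((3 * N + j * (13 * N)) + (N + N + (N + N + (N + N + (N + N + 0)))))) + N
        ≡ 3 * N + suc j * (13 * N)
    e = solve-∀

divMod-cost : ∀ a b M j → 1 ≤ b → b ≤ M → a ≤ M → a < 2 ^ j * b →
              cost (divMod a b) ≤ 3 * bits M + j * (13 * bits M)
divMod-cost a b M j 1≤b b≤M a≤M = divMod′-cost a a b M j 1≤b a≤M (≤-trans b≤M (m≤m+n M M))

-- Binary logarithms and the Euclidean algorithm

n<2^[1+⌊log₂n⌋] : ∀ n → n < 2 ^ suc ⌊log₂ n ⌋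
n<2^[1+⌊log₂n⌋] n with n <? 2 ^ suc ⌊log₂ n ⌋
... | yes n<2^ = n<2^
... | no  n≮2^ = contradiction
  (≤-trans (≤-reflexive (sym (⌊log₂[2^n]⌋≡n (suc ⌊log₂ n ⌋)))) (⌊log₂⌋-mono-≤ (≮⇒≥ n≮2^))) 1+n≰n

n<2^[1+k]⇒⌊log₂n⌋≤k : ∀ k n → n < 2 ^ suc k → ⌊log₂ n ⌋ ≤ k
n<2^[1+k]⇒⌊log₂n⌋≤k zero    zero          _ = z≤n
n<2^[1+k]⇒⌊log₂n⌋≤k zero    (suc zero)    _ = z≤n
n<2^[1+k]⇒⌊log₂n⌋≤k zero    (suc (suc n)) (s≤s (s≤s ()))
n<2^[1+k]⇒⌊log₂n⌋≤k (suc k) n n<2^ = begin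
  ⌊log₂ n ⌋              ≤⟨ m≤n+m∸n ⌊log₂ n ⌋ 1 ⟩
  1 + (⌊log₂ n ⌋ ∸ 1)    ≡⟨ cong suc (⌊log₂⌊n/2⌋⌋≡⌊log₂n⌋∸1 n) ⟨
  1 + ⌊log₂ ⌊ n /2⌋ ⌋    ≤⟨ s≤s (n<2^[1+k]⇒⌊log₂n⌋≤k k ⌊ n /2⌋
                              (double-cancel-< _ _ (≤-<-trans (⌊n/2⌋+⌊n/2⌋≤n n)
                                (<-≤-trans n<2^ (≤-reflexive (cong (2 ^ suc k +_) (+-identityʳ _))))))) ⟩
  suc k ∎
  where open ≤-Reasoning

2^⌊log₂n⌋≤n : ∀ n → 1 ≤ n → 2 ^ ⌊log₂ n ⌋ ≤ n
2^⌊log₂n⌋≤n n 1≤n with ⌊log₂ n ⌋ in eq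
... | zero  = 1≤n
... | suc l with n <? 2 ^ suc l
...   | no  n≮2^ = ≮⇒≥ n≮2^
...   | yes n<2^ = contradiction (≤-trans (≤-reflexive (sym eq)) (n<2^[1+k]⇒⌊log₂n⌋≤k l n n<2^)) 1+n≰n

⌊log₂mn⌋≤ : ∀ m n → ⌊log₂ m * n ⌋ ≤ suc (⌊log₂ m ⌋ + ⌊log₂ n ⌋)
⌊log₂mn⌋≤ m n = n<2^[1+k]⇒⌊log₂n⌋≤k _ (m * n) (begin-strict
  m * n <⟨ *-mono-< (n<2^[1+⌊log₂n⌋] m) (n<2^[1+⌊log₂n⌋] n) ⟩
  2 ^ suc ⌊log₂ m ⌋ * 2 ^ suc ⌊log₂ n ⌋ ≡⟨ ^-distribˡ-+-* 2 (suc ⌊log₂ m ⌋) (suc ⌊log₂ n ⌋) ⟨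
  2 ^ (suc ⌊log₂ m ⌋ + suc ⌊log₂ n ⌋) ≡⟨ cong (λ e → 2 ^ suc e) (+-suc ⌊log₂ m ⌋ ⌊log₂ n ⌋) ⟩
  2 ^ suc (suc (⌊log₂ m ⌋ + ⌊log₂ n ⌋)) ∎)
  where open ≤-Reasoning

-- Bounds the rounds of dividing `a` by `b` and, after cancelling `b`, the bit length of the
-- quotient.
a<2^[1+⌊log₂a⌋∸⌊log₂b⌋]*b : ∀ a b → 1 ≤ b → b ≤ a → a < 2 ^ suc (⌊log₂ a ⌋ ∸ ⌊log₂ b ⌋) * b
a<2^[1+⌊log₂a⌋∸⌊log₂b⌋]*b a b 1≤b b≤a = begin-strict
  a                                           <⟨ n<2^[1+⌊log₂n⌋] a ⟩
  2 ^ suc ⌊log₂ a ⌋                           ≡⟨ cong (λ e → 2 ^ suc e) (m∸n+n≡m (⌊log₂⌋-mono-≤ b≤a)) ⟨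
  2 ^ (suc d + ⌊log₂ b ⌋)                     ≡⟨ ^-distribˡ-+-* 2 (suc d) ⌊log₂ b ⌋ ⟩
  2 ^ suc d * 2 ^ ⌊log₂ b ⌋                   ≤⟨ *-monoʳ-≤ (2 ^ suc d) (2^⌊log₂n⌋≤n b 1≤b) ⟩
  2 ^ suc d * b ∎
  where
  open ≤-Reasoning
  d = ⌊log₂ a ⌋ ∸ ⌊log₂ b ⌋

-- Doubling adds 1 to the logarithm except at `m = 0`, where `⌊log₂ 0 ⌋` is 0 and `2 ≤ n` is used
-- instead.
⌊log₂⌋-suc-≤ : ∀ {m n} → 2 ≤ n → m + m ≤ n → suc ⌊log₂ m ⌋ ≤ ⌊log₂ n ⌋
⌊log₂⌋-suc-≤ {zero}  2≤n _    = ⌊log₂⌋-mono-≤ 2≤n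
⌊log₂⌋-suc-≤ {m@(suc _)} _ 2m≤n = ≤-trans
  (≤-reflexive (trans (sym (⌊log₂[2*b]⌋≡1+⌊log₂b⌋ m)) (cong (λ k → ⌊log₂ m + k ⌋) (+-identityʳ m))))
  (⌊log₂⌋-mono-≤ 2m≤n)

-- The size bounds are part of the invariant: back-substitution preserves them, and `∣ t ∣ < a` lets
-- `negMod` reduce by a single subtraction.
Bezout : ℕ → ℕ → ℤ × ℤ → Set
Bezout a b (s , t) = s ℤ.* ℤ.+ a ℤ.+ t ℤ.* ℤ.+ b ≡ 1ℤ × ∣ s ∣ < b × ∣ t ∣ < a

coprime-step : ∀ {a b q r} → q * b + r ≡ a → Coprime a b → Coprime b r
coprime-step {b = b} {q} refl a⊥b (d∣b , d∣r) = a⊥b (∣m∣n⇒∣m+n (∣n⇒∣m*n q d∣b) d∣r , d∣b)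

egcd′-value-zero : ∀ k a → value (egcd′ k a 0) ≡ (1ℤ , 0ℤ)
egcd′-value-zero zero    a = refl
egcd′-value-zero (suc k) a = refl

back-substitute : ∀ s t {a b} q {r} → q * b + r ≡ a →
                  s ℤ.* ℤ.+ b ℤ.+ t ℤ.* ℤ.+ r ≡ t ℤ.* ℤ.+ a ℤ.+ (s ℤ.- ℤ.+ q ℤ.* t) ℤ.* ℤ.+ b
back-substitute s t {a} {b} q {r} qb+r≡a =
  trans (lemma s t (ℤ.+ q) (ℤ.+ b) (ℤ.+ r))
        (cong (λ i → t ℤ.* i ℤ.+ (s ℤ.- ℤ.+ q ℤ.* t) ℤ.* ℤ.+ b) pos-qb+r≡a)
  where
  pos-qb+r≡a : ℤ.+ q ℤ.* ℤ.+ b ℤ.+ ℤ.+ r ≡ ℤ.+ a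
  pos-qb+r≡a = trans (cong (ℤ._+ ℤ.+ r) (sym (ℤ.pos-* q b)))
    (trans (sym (ℤ.pos-+ (q * b) r)) (cong ℤ.+_ qb+r≡a))
  lemma : ∀ s t q b r → s ℤ.* b ℤ.+ t ℤ.* r ≡ t ℤ.* (q ℤ.* b ℤ.+ r) ℤ.+ (s ℤ.- q ℤ.* t) ℤ.* b
  lemma = ℤ-Solver.solve-∀

-- The induction starts at remainder 0, not at `b = 0`, where the coefficients 1 and 0 would violate
-- the strict bounds. At remainder 0 coprimality forces `b = 1`, and the coefficients are 0 and 1.
-- Otherwise the new coefficient is smaller in size than `r + q * b = a`.
egcd′-spec : ∀ k a b → 1 ≤ b → b < a → b < k → Coprime a b → Bezout a b (value (egcd′ k a b))
egcd′-spec (suc k) a b@(suc _) 1≤b b<a (s≤s b≤k) a⊥b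
  with value (divMod a b) | divMod-sum a b | divMod-rem a b 1≤b
... | q , zero | a≡qb | _
  rewrite egcd′-value-zero k b | mul-value q 0 | *-zeroʳ q =
  cong (1ℤ ℤ.*_) (cong ℤ.+_ b≡1) , 1≤b , ≤-<-trans 1≤b b<a
  where
  b≡1 : b ≡ 1
  b≡1 = coprime-step {q = q} a≡qb a⊥b (∣-refl , b ∣0)
... | q , r@(suc _) | a≡qb+r | r<b
  with value (egcd′ k b r)
     | egcd′-spec k b r (s≤s z≤n) r<b (<-≤-trans r<b b≤k) (coprime-step {q = q} a≡qb+r a⊥b)
... | s , t | bez , ∣s∣<r , ∣t∣<b rewrite mul-value q ∣ t ∣ =
  trans (sym (back-substitute s t q a≡qb+r)) bez , ∣t∣<b , (begin-strict
    ∣ s ℤ.- ℤ.+ q ℤ.* t ∣            ≤⟨ ℤ.∣i-j∣≤∣i∣+∣j∣ s (ℤ.+ q ℤ.* t) ⟩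
    ∣ s ∣ + ∣ ℤ.+ q ℤ.* t ∣          ≡⟨ cong (∣ s ∣ +_) (ℤ.abs-* (ℤ.+ q) t) ⟩
    ∣ s ∣ + q * ∣ t ∣                <⟨ +-mono-<-≤ ∣s∣<r (*-monoʳ-≤ q (<⇒≤ ∣t∣<b)) ⟩
    r + q * b                        ≡⟨ trans (+-comm r (q * b)) a≡qb+r ⟩
    a                                ∎)
  where open ≤-Reasoning

-- Weak bounds that also cover `b = 0`, as the cost estimate needs for the last recursive call.
egcd′-bounded : ∀ k a b → b < a → b < k → Coprime a b →
                let (s , t) = value (egcd′ k a b) in ∣ s ∣ ≤ a × ∣ t ∣ ≤ a
egcd′-bounded k a zero      0<a _   _   rewrite egcd′-value-zero k a = 0<a , z≤n
egcd′-bounded k a b@(suc _) b<a b<k a⊥b =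
  let _ , ∣s∣<b , ∣t∣<a = egcd′-spec k a b (s≤s z≤n) b<a b<k a⊥b
  in <⇒≤ (<-trans ∣s∣<b b<a) , <⇒≤ ∣t∣<a

-- log a + log b is a potential: a step replaces it by log b + log r, where
-- 2r ≤ a, so it falls by log a - log r ≥ max(1, log a - log b), which is what
-- the number of rounds of the division and of the multiplication amounts to.
egcd′-cost : ∀ k a b M → b < a → b < k → a ≤ M → Coprime a b →
             cost (egcd′ k a b) ≤ 2 + 49 * bits M * (⌊log₂ a ⌋ + ⌊log₂ b ⌋)
egcd′-cost (suc k) a zero      M _   _         _   _   = m≤m+n 2 _
egcd′-cost (suc k) a b@(suc _) M b<a (s≤s b≤k) a≤M a⊥b = begin
  _ ≤⟨ +-mono-≤ (+-mono-≤ (bits-mono-≤ b≤M) (s≤s z≤n)) (+-mono-≤ cost-divMod (+-mono-≤ rec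
         (+-mono-≤ cost-mul (+-monoˡ-≤ 0 (+-mono-≤ (bits-mono-≤ ∣s∣≤M) (bits-mono-≤ ∣u∣≤M)))))) ⟩
  N + N + (3 * N + suc d * (13 * N) + (2 + 49 * N * (Lb + Lr) + (2 + suc d * (7 * N) + (N + N + 0))))
    ≤⟨ lemma N d e Lb Lr (s≤s z≤n) 1≤e d≤e ⟩
  2 + 49 * N * ((Lr + e) + Lb)
    ≡⟨ cong (λ l → 2 + 49 * N * (l + Lb)) (m+[n∸m]≡n (≤-trans (n≤1+n Lr) Lr<La)) ⟩
  2 + 49 * N * (La + Lb) ∎
  where
  open ≤-Reasoning
  q = proj₁ (value (divMod a b))
  r = proj₂ (value (divMod a b))
  s = proj₁ (value (egcd′ k b r))
  t = proj₂ (value (egcd′ k b r))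
  a≡qb+r = divMod-sum a b
  r<b : r < b
  r<b = divMod-rem a b (s≤s z≤n)
  b⊥r : Coprime b r
  b⊥r = coprime-step {q = q} a≡qb+r a⊥b
  r<k = <-≤-trans r<b b≤k
  N = bits M
  La = ⌊log₂ a ⌋
  Lb = ⌊log₂ b ⌋
  Lr = ⌊log₂ r ⌋
  d = La ∸ Lb
  e = La ∸ Lr
  b≤M = ≤-trans (<⇒≤ b<a) a≤M
  a<2^jb : a < 2 ^ suc d * b
  a<2^jb = a<2^[1+⌊log₂a⌋∸⌊log₂b⌋]*b a b (s≤s z≤n) (<⇒≤ b<a)
  qb≤a : q * b ≤ a
  qb≤a = ≤-trans (m≤m+n (q * b) r) (≤-reflexive a≡qb+r)
  0<q : 0 < q
  0<q = n≢0⇒n>0 λ q≡0 → <-irrefl (trans (cong (λ q → q * b + r) (sym q≡0)) a≡qb+r) (<-trans r<b b<a)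
  2r≤a : r + r ≤ a
  2r≤a = ≤-trans (+-monoˡ-≤ r (≤-trans (<⇒≤ r<b) (≤-trans (≤-reflexive (sym (*-identityˡ b))) (*-monoˡ-≤ b 0<q))))
    (≤-reflexive a≡qb+r)
  Lr<La : suc Lr ≤ La
  Lr<La = ⌊log₂⌋-suc-≤ {r} (≤-trans (s≤s (s≤s z≤n)) b<a) 2r≤a
  1≤e : 1 ≤ e
  1≤e = m<n⇒0<n∸m Lr<La
  d≤e : d ≤ e
  d≤e = ∸-monoʳ-≤ La (⌊log₂⌋-mono-≤ (<⇒≤ r<b))
  cost-divMod = divMod-cost a b M (suc d) (s≤s z≤n) b≤M a≤M a<2^jb
  ∣s∣≤M = ≤-trans (proj₁ (egcd′-bounded k b r r<b r<k b⊥r)) b≤M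
  ∣t∣≤b = proj₂ (egcd′-bounded k b r r<b r<k b⊥r)
  q∣t∣≤M = ≤-trans (*-monoʳ-≤ q ∣t∣≤b) (≤-trans qb≤a a≤M)
  q≤M = ≤-trans (≤-trans (≤-reflexive (sym (*-identityʳ q))) (*-monoʳ-≤ q (s≤s z≤n))) (≤-trans qb≤a a≤M)
  cost-mul = mul-cost q ∣ t ∣ M (suc d) (*-cancelʳ-< b q _ (≤-<-trans qb≤a a<2^jb))
               q≤M (≤-trans ∣t∣≤b b≤M) q∣t∣≤M
  ∣u∣≤M : ∣ sign t ◃ value (mul q ∣ t ∣) ∣ ≤ M
  ∣u∣≤M = ≤-trans (≤-reflexive (trans (ℤ.abs-◃ (sign t) _) (mul-value q ∣ t ∣))) q∣t∣≤M
  rec = egcd′-cost k b r M r<b r<k b≤M b⊥r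
  -- The constant is 49 = 2 + 27 + 20: a surplus summand 2, the `27 * N` of a step that do not
  -- depend on `d`, and 13 + 7 for each of the `d` further rounds of division and multiplication.
  -- All are absorbed by `e`, the drop of the potential.
  lemma : ∀ N d e Lb Lr → 1 ≤ N → 1 ≤ e → d ≤ e →
    N + N + (3 * N + suc d * (13 * N) + (2 + 49 * N * (Lb + Lr) + (2 + suc d * (7 * N) + (N + N + 0))))
    ≤ 2 + 49 * N * ((Lr + e) + Lb)
  lemma N d e Lb Lr 1≤N 1≤e d≤e = begin
    _ ≡⟨ e₁ N d Lb Lr ⟩
    2 * 1 + N * 27 * 1 + N * 20 * d + (2 + 49 * N * (Lr + Lb))
      ≤⟨ +-monoˡ-≤ _ (+-mono-≤ (+-mono-≤ (*-mono-≤ (*-monoʳ-≤ 2 1≤N) 1≤e) (*-monoʳ-≤ (N * 27) 1≤e))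
                               (*-monoʳ-≤ (N * 20) d≤e)) ⟩
    2 * N * e + N * 27 * e + N * 20 * e + (2 + 49 * N * (Lr + Lb)) ≡⟨ e₂ N e Lb Lr ⟩
    2 + 49 * N * ((Lr + e) + Lb) ∎
    where
    e₁ : ∀ N d Lb Lr →
      N + N + (3 * N + suc d * (13 * N) + (2 + 49 * N * (Lb + Lr) + (2 + suc d * (7 * N) + (N + N + 0))))
       ≡ 2 * 1 + N * 27 * 1 + N * 20 * d + (2 + 49 * N * (Lr + Lb))
    e₁ = solve-∀
    e₂ : ∀ N e Lb Lr → 2 * N * e + N * 27 * e + N * 20 * e + (2 + 49 * N * (Lr + Lb))
       ≡ 2 + 49 * N * ((Lr + e) + Lb)
    e₂ = solve-∀

-- The number i* and the partition it yields

-- Modulo `b₁` the number `b₁ ∸ 1` is -1, so i* is minus the inverse of τ; divisibility of the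
-- successor expresses this without remainders.
Isi*⇒∣ : ∀ {b₁ b₂ i} .{{_ : NonZero b₁}} → Isi* b₁ b₂ i → b₁ ∣ suc (b₂ % b₁ * i)
Isi*⇒∣ {b₁@(suc m)} {b₂} {i} (_ , _ , eq) = divides (suc (x / b₁)) (begin
  suc x                          ≡⟨ cong suc (m≡m%n+[m/n]*n x b₁) ⟩
  suc (x % b₁ + x / b₁ * b₁)     ≡⟨ cong (λ y → suc (y + x / b₁ * b₁)) (trans eq (m<n⇒m%n≡m (n<1+n m))) ⟩
  suc (m + x / b₁ * b₁)          ∎)
  where
  open ≡-Reasoning
  x = b₂ % b₁ * i

∣⇒Isi* : ∀ {b₁ b₂ i} .{{_ : NonZero b₁}} → 1 ≤ i → i ≤ b₁ ∸ 1 → b₁ ∣ suc (b₂ % b₁ * i) → Isi* b₁ b₂ i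
∣⇒Isi* {b₁@(suc m)} 1≤i i≤ b₁∣ =
  1≤i , i≤ , trans (%-pred-≡0 (n∣m⇒m%n≡0 _ b₁ b₁∣)) (sym (m<n⇒m%n≡m (n<1+n m)))

∣-small : ∀ {m n} → m ∣ n → n < m → n ≡ 0
∣-small {n = zero}  _   _   = refl
∣-small {n = suc _} m∣n n<m = contradiction n<m (≤⇒≯ (∣⇒≤ m∣n))

-- Subtracting the two multiples shows that `m` divides `τ * (j ∸ i)`, hence `j ∸ i`, which is less
-- than `m`.
inverse-unique-≤ : ∀ {m τ i j} → Coprime m τ → i ≤ j → j < m → m ∣ suc (τ * i) → m ∣ suc (τ * j) → i ≡ j
inverse-unique-≤ {m} {τ} {i} {j} m⊥τ i≤j j<m m∣i m∣j =
  ≤-antisym i≤j (m∸n≡0⇒m≤n (∣-small (coprime-divisor m⊥τ m∣τ[j∸i]) (≤-<-trans (m∸n≤m j i) j<m)))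
  where
  eq : suc (τ * i) + τ * (j ∸ i) ≡ suc (τ * j)
  eq = cong suc (trans (sym (*-distribˡ-+ τ i (j ∸ i))) (cong (τ *_) (m+[n∸m]≡n i≤j)))
  m∣τ[j∸i] : m ∣ τ * (j ∸ i)
  m∣τ[j∸i] = ∣m+n∣m⇒∣n (subst (m ∣_) (sym eq) m∣j) m∣i

inverse-unique : ∀ {m τ i j} → Coprime m τ → i < m → j < m → m ∣ suc (τ * i) → m ∣ suc (τ * j) → i ≡ j
inverse-unique {i = i} {j} m⊥τ i<m j<m m∣i m∣j with ≤-total i j
... | inj₁ i≤j = inverse-unique-≤ m⊥τ i≤j j<m m∣i m∣j
... | inj₂ j≤i = sym (inverse-unique-≤ m⊥τ j≤i i<m m∣j m∣i)

-- The witness `u` is 1 for positive `t` and 0 for negative `t`. At `t = 0` the result would be `m`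
-- itself, outside the range.
negMod-spec : ∀ t m → t ≢ 0ℤ → ∣ t ∣ < m → let i = value (negMod t m) in
              1 ≤ i × i ≤ m ∸ 1 × ∃[ u ] (ℤ.+ i ≡ u ℤ.* ℤ.+ m ℤ.- t)
negMod-spec (ℤ.+ zero)    m t≢0 _  = contradiction refl t≢0
negMod-spec t@(ℤ.+ suc n) m _   n<m = m<n⇒0<n∸m n<m , ∸-monoʳ-≤ m (s≤s z≤n) , 1ℤ , (begin
  ℤ.+ (m ∸ suc n)        ≡⟨ ℤ.⊖-≥ (<⇒≤ n<m) ⟨
  m ℤ.⊖ suc n            ≡⟨ ℤ.m-n≡m⊖n m (suc n) ⟨
  ℤ.+ m ℤ.- t            ≡⟨ cong (ℤ._- t) (ℤ.*-identityˡ (ℤ.+ m)) ⟨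
  1ℤ ℤ.* ℤ.+ m ℤ.- t     ∎)
  where open ≡-Reasoning
negMod-spec ℤ.-[1+ n ]    (suc m) _ (s≤s n<m) = s≤s z≤n , n<m , 0ℤ , refl

-- Modulo `m` the Bézout identity says `t * τ ≡ 1`, and `i ≡ - t`.
bezout⇒inverse : ∀ {s t u : ℤ} {m τ i} → s ℤ.* ℤ.+ m ℤ.+ t ℤ.* ℤ.+ τ ≡ 1ℤ → ℤ.+ i ≡ u ℤ.* ℤ.+ m ℤ.- t →
                 m ∣ suc (τ * i)
bezout⇒inverse {s} {t} {u} {m} {τ} {i} bez i≡ =
  ℤ.∣⇒∣ᵤ {ℤ.+ m} {ℤ.+ suc (τ * i)} (ℤ.divides (s ℤ.+ ℤ.+ τ ℤ.* u) (begin
  ℤ.+ (1 + τ * i)                   ≡⟨ ℤ.pos-+ 1 (τ * i) ⟩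
  1ℤ ℤ.+ ℤ.+ (τ * i)                ≡⟨ cong (λ x → 1ℤ ℤ.+ x) (ℤ.pos-* τ i) ⟩
  1ℤ ℤ.+ ℤ.+ τ ℤ.* ℤ.+ i            ≡⟨ cong₂ (λ x y → x ℤ.+ ℤ.+ τ ℤ.* y) (sym bez) i≡ ⟩
  (s ℤ.* ℤ.+ m ℤ.+ t ℤ.* ℤ.+ τ) ℤ.+ ℤ.+ τ ℤ.* (u ℤ.* ℤ.+ m ℤ.- t) ≡⟨ lemma s t u (ℤ.+ m) (ℤ.+ τ) ⟩
  (s ℤ.+ ℤ.+ τ ℤ.* u) ℤ.* ℤ.+ m     ∎))
  where
  open ≡-Reasoning
  lemma : ∀ s t u m τ → (s ℤ.* m ℤ.+ t ℤ.* τ) ℤ.+ τ ℤ.* (u ℤ.* m ℤ.- t) ≡ (s ℤ.+ τ ℤ.* u) ℤ.* m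
  lemma = ℤ-Solver.solve-∀

%-unique : ∀ {a b q r} .{{_ : NonZero b}} → q * b + r ≡ a → r < b → r ≡ a % b
%-unique {a} {b} {q} {r} eq r<b = begin
  r                ≡⟨ m<n⇒m%n≡m r<b ⟨
  r % b            ≡⟨ [m+kn]%n≡m%n r q b ⟨
  (r + q * b) % b  ≡⟨ cong (_% b) (trans (+-comm r (q * b)) eq) ⟩
  a % b            ∎
  where open ≡-Reasoning

coprime-% : ∀ {b₁ b₂} .{{_ : NonZero b₁}} → Coprime b₁ b₂ → Coprime b₁ (b₂ % b₁)
coprime-% {b₁} {b₂} b₁⊥b₂ =
  coprime-step {q = b₂ / b₁} (trans (+-comm _ (b₂ % b₁)) (sym (m≡m%n+[m/n]*n b₂ b₁))) (Coprime.sym b₁⊥b₂)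

coprime⇒>0 : ∀ {m n} → 2 ≤ m → Coprime m n → 1 ≤ n
coprime⇒>0 {m} {zero}  2≤m m⊥0 = contradiction 2≤m (<⇒≱ (s≤s (≤-reflexive (m⊥0 (∣-refl , m ∣0)))))
coprime⇒>0 {m} {suc n} _   _   = s≤s z≤n

-- With `t = 0` the Bézout identity would make `m` a divisor of 1.
coefficient≢0 : ∀ {m n p} → 2 ≤ m → Bezout m n p → proj₂ p ≢ 0ℤ
coefficient≢0 {m} {n} {s , _} 2≤m (bez , _) refl = contradiction 2≤m (<⇒≱ (s≤s (≤-reflexive m≡1)))
  where
  m≡1 : m ≡ 1
  m≡1 = ∣1⇒≡1 (ℤ.∣⇒∣ᵤ {ℤ.+ m} {1ℤ} (ℤ.divides s (trans (sym bez) (ℤ.+-identityʳ _))))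

egcd-spec : ∀ a b → 1 ≤ b → b < a → Coprime a b → Bezout a b (value (egcd a b))
egcd-spec a b 1≤b b<a = egcd′-spec (suc b) a b 1≤b b<a (n<1+n b)

computei*-Isi* : ∀ b₁ b₂ .{{_ : NonZero b₁}} → 2 ≤ b₁ → Coprime b₁ b₂ →
                 Isi* b₁ b₂ (value (computei* b₁ b₂))
computei*-Isi* b₁ b₂ 2≤b₁ b₁⊥b₂
  rewrite %-unique {q = proj₁ (value (divMod b₂ b₁))} (divMod-sum b₂ b₁) (divMod-rem b₂ b₁ (<⇒≤ 2≤b₁)) =
  let bezout = egcd-spec b₁ τ (coprime⇒>0 2≤b₁ b₁⊥τ) (m%n<n b₂ b₁) b₁⊥τ
      s , t  = value (egcd b₁ τ)
      1≤i , i≤ , u , eq = negMod-spec t b₁ (coefficient≢0 {p = s , t} 2≤b₁ bezout) (proj₂ (proj₂ bezout))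
  in ∣⇒Isi* {b₁} {b₂} 1≤i i≤ (bezout⇒inverse {s} {t} {u} {b₁} {τ} (proj₁ bezout) eq)
  where
  τ = b₂ % b₁
  b₁⊥τ = coprime-% b₁⊥b₂

Isi*-< : ∀ {b₁ b₂ i} .{{_ : NonZero b₁}} → Isi* b₁ b₂ i → i < b₁
Isi*-< {suc m} (_ , i≤m , _) = s≤s i≤m

-- Identifies the computed number with any given i*.
Isi*-unique : ∀ {b₁ b₂ i j} .{{_ : NonZero b₁}} → Coprime b₁ b₂ → Isi* b₁ b₂ i → Isi* b₁ b₂ j → i ≡ j
Isi*-unique {b₁} {b₂} {i} {j} b₁⊥b₂ I J =
  inverse-unique (coprime-% b₁⊥b₂) (Isi*-< {b₁} {b₂} {i} I) (Isi*-< {b₁} {b₂} {j} J)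
    (Isi*⇒∣ {b₁} {b₂} {i} I) (Isi*⇒∣ {b₁} {b₂} {j} J)

ceilDiv-spec : ∀ a b → 1 ≤ b → let c = value (ceilDiv a b) in a ≤ c * b × c * b < a + b
ceilDiv-spec a b 1≤b with value (divMod a b) | divMod-sum a b | divMod-rem a b 1≤b
... | q , zero    | eq | _ = ≤-reflexive (sym qb≡a) , ≤-<-trans (≤-reflexive qb≡a) (m<m+n a 1≤b)
  where
  qb≡a : q * b ≡ a
  qb≡a = trans (sym (+-identityʳ _)) eq
... | q , suc r   | eq | r<b = (begin
    a                  ≡⟨ eq ⟨
    q * b + suc r      ≤⟨ +-monoʳ-≤ (q * b) (<⇒≤ r<b) ⟩
    q * b + b          ≡⟨ lemma q b ⟩
    (q + 1) * b        ∎) , (begin-strict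
    (q + 1) * b        ≡⟨ lemma q b ⟨
    q * b + b          <⟨ +-monoˡ-< b (m<m+n (q * b) (s≤s z≤n)) ⟩
    q * b + suc r + b  ≡⟨ cong (_+ b) eq ⟩
    a + b              ∎)
  where
  open ≤-Reasoning
  lemma : ∀ q b → q * b + b ≡ (q + 1) * b
  lemma = solve-∀

-- `floor` unfolds only on a constructor, so the matches on `record{}` expose the integer division
-- inside.
ceiling-≡ : ∀ p → ceiling p ≡ ℤ.- (↥ (ℚ.- p) ℤ./ ↧ (ℚ.- p))
ceiling-≡ p@record{} = cong ℤ.-_ (floor-≡ (ℚ.- p))
  where
  floor-≡ : ∀ p → floor p ≡ ↥ p ℤ./ ↧ p
  floor-≡ record{} = refl

<-suc⇒≤ : ∀ {i j} → i ℤ.< ℤ.suc j → i ℤ.≤ j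
<-suc⇒≤ {i} {j} i<1+j = subst (i ℤ.≤_) (ℤ.pred-suc j) (ℤ.i<j⇒i≤pred[j] i<1+j)

/-unique : ∀ n d c .{{_ : ℤ.Positive d}} .{{_ : ℤ.NonZero d}} →
           c ℤ.* d ℤ.≤ n → n ℤ.< ℤ.suc c ℤ.* d → n ℤ./ d ≡ c
/-unique n d@(ℤ.+[1+ k ]) c lower upper = ℤ.≤-antisym
  (<-suc⇒≤ (ℤ.*-cancelʳ-<-nonNeg d (ℤ.≤-<-trans (ℤ.[n/d]*d≤n n d) upper)))
  (<-suc⇒≤ (ℤ.*-cancelʳ-<-nonNeg d (ℤ.≤-<-trans lower
    (subst (λ w → n ℤ.< ℤ.suc w ℤ.* d) (sym (ℤ.div-pos-is-/ℕ n (suc k))) (ℤ.n<s[n/ℕd]*d n (suc k))))))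

-- Numerator and denominator of `p` are in lowest terms, so the inequalities are multiplied by the
-- gcd `g` to return to `n` and `d`. Since the ceiling is minus the floor of `- p`, the quotient to
-- be identified is `- c`.
∣ceiling∣-unique : ∀ n d c .{{_ : NonZero d}} → n ≤ c * d → c * d < n + d → ∣ ceiling (ℤ.+ n ℚ./ d) ∣ ≡ c
∣ceiling∣-unique n d c n≤cd cd<n+d =
  trans (cong ∣_∣ (trans (ceiling-≡ p) (cong ℤ.-_ w≡-c))) (cong ∣_∣ (ℤ.neg-involutive (ℤ.+ c)))
  where
  open ℤ.≤-Reasoning
  p = ℤ.+ n ℚ./ d
  g = ℤ.+ gcd n d
  instance
    g>0 : ℤ.Positive g
    g>0 = ℤ.positive (ℤ.+<+ (n≢0⇒n>0 (gcd[m,n]≢0 n d (inj₂ (≢-nonZero⁻¹ d)))))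
  num : ↥ p ℤ.* g ≡ ℤ.+ n
  num = ℚ.↥-/ (ℤ.+ n) d
  den : ↧ p ℤ.* g ≡ ℤ.+ d
  den = ℚ.↧-/ (ℤ.+ n) d
  scale : ∀ i → i ℤ.* ↧ (ℚ.- p) ℤ.* g ≡ i ℤ.* ℤ.+ d
  scale i = trans (ℤ.*-assoc i _ g) (cong (i ℤ.*_) (trans (cong (ℤ._* g) (ℚ.↧-neg p)) den))
  negnum : ↥ (ℚ.- p) ℤ.* g ≡ ℤ.- ℤ.+ n
  negnum = trans (cong (ℤ._* g) (ℚ.↥-neg p)) (trans (sym (ℤ.neg-distribˡ-* (↥ p) g)) (cong ℤ.-_ num))
  lower : (ℤ.- ℤ.+ c) ℤ.* ↧ (ℚ.- p) ℤ.≤ ↥ (ℚ.- p)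
  lower = ℤ.*-cancelʳ-≤-pos _ _ g (begin
    (ℤ.- ℤ.+ c) ℤ.* ↧ (ℚ.- p) ℤ.* g ≡⟨ scale (ℤ.- ℤ.+ c) ⟩
    (ℤ.- ℤ.+ c) ℤ.* ℤ.+ d           ≡⟨ ℤ.neg-distribˡ-* (ℤ.+ c) (ℤ.+ d) ⟨
    ℤ.- (ℤ.+ c ℤ.* ℤ.+ d)           ≡⟨ cong ℤ.-_ (ℤ.pos-* c d) ⟨
    ℤ.- ℤ.+ (c * d)                 ≤⟨ ℤ.neg-mono-≤ (ℤ.+≤+ n≤cd) ⟩
    ℤ.- ℤ.+ n                       ≡⟨ negnum ⟨
    ↥ (ℚ.- p) ℤ.* g ∎)
  upper : ↥ (ℚ.- p) ℤ.< ℤ.suc (ℤ.- ℤ.+ c) ℤ.* ↧ (ℚ.- p)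
  upper = ℤ.*-cancelʳ-<-nonNeg g (begin-strict
    ↥ (ℚ.- p) ℤ.* g                         ≡⟨ negnum ⟩
    ℤ.- ℤ.+ n                               ≡⟨ shift (ℤ.+ n) (ℤ.+ d) ⟩
    ℤ.+ d ℤ.- (ℤ.+ n ℤ.+ ℤ.+ d)             ≡⟨ cong (λ x → ℤ.+ d ℤ.- x) (ℤ.pos-+ n d) ⟨
    ℤ.+ d ℤ.- ℤ.+ (n + d)                   <⟨ ℤ.+-monoʳ-< (ℤ.+ d) (ℤ.neg-mono-< (ℤ.+<+ cd<n+d)) ⟩
    ℤ.+ d ℤ.- ℤ.+ (c * d)                   ≡⟨ cong (λ x → ℤ.+ d ℤ.- x) (ℤ.pos-* c d) ⟩
    ℤ.+ d ℤ.- ℤ.+ c ℤ.* ℤ.+ d               ≡⟨ factor (ℤ.+ c) (ℤ.+ d) ⟩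
    ℤ.suc (ℤ.- ℤ.+ c) ℤ.* ℤ.+ d             ≡⟨ scale (ℤ.suc (ℤ.- ℤ.+ c)) ⟨
    ℤ.suc (ℤ.- ℤ.+ c) ℤ.* ↧ (ℚ.- p) ℤ.* g   ∎)
    where
    shift : ∀ n d → ℤ.- n ≡ d ℤ.- (n ℤ.+ d)
    shift = ℤ-Solver.solve-∀
    factor : ∀ c d → d ℤ.- c ℤ.* d ≡ (1ℤ ℤ.+ ℤ.- c) ℤ.* d
    factor = ℤ-Solver.solve-∀
  w≡-c : ↥ (ℚ.- p) ℤ./ ↧ (ℚ.- p) ≡ ℤ.- ℤ.+ c
  w≡-c = /-unique (↥ (ℚ.- p)) (↧ (ℚ.- p)) (ℤ.- ℤ.+ c) lower upper

-- This is det (b , x) = 1. The multiple of `b₁` dropped in passing from `b₂` to its residue is put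
-- back by adding `b₂ / b₁ * i` to the quotient.
i*-determinant : ∀ b₁ b₂ {i} .{{_ : NonZero b₁}} → Isi* b₁ b₂ i → ∃[ c ] (c * b₁ ≡ suc (b₂ * i))
i*-determinant b₁ b₂ {i} I with Isi*⇒∣ {b₁} {b₂} {i} I
... | divides c 1+τi≡cb₁ = c + b₂ / b₁ * i , (begin
  (c + b₂ / b₁ * i) * b₁                    ≡⟨ expand c (b₂ / b₁) i b₁ ⟩
  c * b₁ + b₂ / b₁ * b₁ * i                 ≡⟨ cong (_+ b₂ / b₁ * b₁ * i) 1+τi≡cb₁ ⟨
  suc (b₂ % b₁ * i) + b₂ / b₁ * b₁ * i      ≡⟨ cong suc (*-distribʳ-+ i (b₂ % b₁) (b₂ / b₁ * b₁)) ⟨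
  suc ((b₂ % b₁ + b₂ / b₁ * b₁) * i)        ≡⟨ cong (λ n → suc (n * i)) (m≡m%n+[m/n]*n b₂ b₁) ⟨
  suc (b₂ * i)                              ∎)
  where
  open ≡-Reasoning
  expand : ∀ c q i b → (c + q * i) * b ≡ c * b + q * b * i
  expand = solve-∀

-- `b₂ * i + 1` is a multiple of `b₁`, and since `b₁ ≥ 2` it exceeds `b₂ * i` by less than `b₁`; so
-- `c` is the ceiling.
part-≡ : ∀ b₁ b₂ {i c} .{{_ : NonZero b₁}} → 2 ≤ b₁ → c * b₁ ≡ suc (b₂ * i) → part b₁ b₂ i ≡ (i , c)
part-≡ b₁ b₂ {i} {c} 2≤b₁ det = cong (i ,_) (∣ceiling∣-unique (b₂ * i) b₁ c
  (≤-trans (n≤1+n _) (≤-reflexive (sym det)))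
  (≤-<-trans (≤-reflexive det) (<-≤-trans (≤-reflexive (+-comm 2 (b₂ * i))) (+-monoʳ-≤ (b₂ * i) 2≤b₁))))

ceilDiv-part : ∀ b₁ b₂ i .{{_ : NonZero b₁}} → (i , value (ceilDiv (b₂ * i) b₁)) ≡ part b₁ b₂ i
ceilDiv-part b₁ b₂ i =
  let lower , upper = ceilDiv-spec (b₂ * i) b₁ (>-nonZero⁻¹ b₁)
  in cong (i ,_) (sym (∣ceiling∣-unique (b₂ * i) b₁ _ lower upper))

computePartition-value : ∀ b₁ b₂ i .{{_ : NonZero b₁}} → 2 ≤ b₁ → Coprime b₁ b₂ → Isi* b₁ b₂ i →
  let x = part b₁ b₂ i in value (computePartition (b₁ , b₂)) ≡ (x , (b₁ , b₂) ⊖ x)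
computePartition-value b₁ b₂ i 2≤b₁ b₁⊥b₂ I
  rewrite Isi*-unique {b₁} {b₂} b₁⊥b₂ (computei*-Isi* b₁ b₂ 2≤b₁ b₁⊥b₂) I | mul-value b₂ i =
  cong (λ x → x , (b₁ , b₂) ⊖ x) (ceilDiv-part b₁ b₂ i)

-- Diversity

-- The right side exceeds the left by `(p - q) * (r - s)`, here `u * v`.
rearrangement : ∀ {p q r s} → q ≤ p → s ≤ r → p * s + q * r ≤ q * s + p * r
rearrangement {p} {q} {r} {s} q≤p s≤r with m≤n⇒∃[o]m+o≡n q≤p | m≤n⇒∃[o]m+o≡n s≤r
... | u , refl | v , refl = ≤-trans (m≤m+n _ (u * v)) (≤-reflexive (lemma q s u v))
  where
  lemma : ∀ q s u v → (q + u) * s + q * (s + v) + u * v ≡ q * s + (q + u) * (s + v)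
  lemma = solve-∀

/-mono-≤-cross : ∀ m n m′ n′ .{{_ : NonZero n}} .{{_ : NonZero n′}} →
                 m * n′ ≤ m′ * n → ℤ.+ m ℚ./ n ℚ.≤ ℤ.+ m′ ℚ./ n′
/-mono-≤-cross m n@(suc k) m′ n′@(suc k′) mn′≤m′n = ℚ.toℚᵘ-cancel-≤ (begin
  ℚ.toℚᵘ (ℤ.+ m ℚ./ n)    ≃⟨ ℚ.toℚᵘ-fromℚᵘ (mkℚᵘ (ℤ.+ m) k) ⟩
  mkℚᵘ (ℤ.+ m) k          ≤⟨ *≤* (ℤ.≤-trans (ℤ.≤-reflexive (sym (ℤ.pos-* m n′)))
                              (ℤ.≤-trans (ℤ.+≤+ mn′≤m′n) (ℤ.≤-reflexive (ℤ.pos-* m′ n)))) ⟩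
  mkℚᵘ (ℤ.+ m′) k′        ≃⟨ ℚ.toℚᵘ-fromℚᵘ (mkℚᵘ (ℤ.+ m′) k′) ⟨
  ℚ.toℚᵘ (ℤ.+ m′ ℚ./ n′)  ∎)
  where open ℚᵘ.≤-Reasoning
/-mono-≤-cross m zero m′ n′ _ = contradiction refl (≢-nonZero⁻¹ 0)
/-mono-≤-cross m (suc n) m′ zero _ = contradiction refl (≢-nonZero⁻¹ 0)

infix 4 _⊒_
-- Slopes are compared by cross-multiplication, so that a vertical y is admitted.
_⊒_ : ℤ₊² → ℤ₊² → Set
(y₁ , y₂) ⊒ (x₁ , x₂) = x₂ * y₁ ≤ y₂ * x₁

-- For x above the diagonal, D decreases as the slope grows, because
-- x₁x₂‖y‖₂² - y₁y₂‖x‖₂² = (x₁y₂ - y₁x₂) (x₂y₂ - x₁y₁).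
D-antitone : ∀ x y .(x≢𝟎 : x ≢ 𝟎) .(y≢𝟎 : y ≢ 𝟎) → proj₁ x ≤ proj₂ x → proj₁ y ≤ proj₂ y → y ⊒ x →
             D y y≢𝟎 ℚ.≤ D x x≢𝟎
D-antitone x@(a , c) y@(a′ , c′) x≢𝟎 y≢𝟎 a≤c a′≤c′ y⊒x =
  /-mono-≤-cross (‖ y ‖₁ ^ 2) ‖ y ‖₂² (‖ x ‖₁ ^ 2) ‖ x ‖₂²
    {{‖‖₂²-nonZero y y≢𝟎}} {{‖‖₂²-nonZero x x≢𝟎}} (begin
    (a′ + c′) ^ 2 * (a ^ 2 + c ^ 2)
      ≡⟨ expand a c a′ c′ ⟩
    (a′ ^ 2 + c′ ^ 2) * (a ^ 2 + c ^ 2) + 2 * ((c′ * a) * (a * a′) + (c * a′) * (c * c′))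
      -- The cross terms are grouped so that the slopes order one pair of factors,
      -- `c * a′ ≤ c′ * a`, and the position above the diagonal the other, `a * a′ ≤ c * c′`.
      ≤⟨ +-monoʳ-≤ ((a′ ^ 2 + c′ ^ 2) * (a ^ 2 + c ^ 2))
           (*-monoʳ-≤ 2 (rearrangement y⊒x (*-mono-≤ a≤c a′≤c′))) ⟩
    (a′ ^ 2 + c′ ^ 2) * (a ^ 2 + c ^ 2) + 2 * ((c * a′) * (a * a′) + (c′ * a) * (c * c′))
      ≡⟨ collect a c a′ c′ ⟩
    (a + c) ^ 2 * (a′ ^ 2 + c′ ^ 2) ∎)
  where
  open ≤-Reasoning
  expand : ∀ a c a′ c′ → ((a′ + c′) * ((a′ + c′) * 1)) * (a * (a * 1) + c * (c * 1))
    ≡ (a′ * (a′ * 1) + c′ * (c′ * 1)) * (a * (a * 1) + c * (c * 1))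
      + 2 * ((c′ * a) * (a * a′) + (c * a′) * (c * c′))
  expand = solve-∀
  collect : ∀ a c a′ c′ →
    (a′ * (a′ * 1) + c′ * (c′ * 1)) * (a * (a * 1) + c * (c * 1))
      + 2 * ((c * a′) * (a * a′) + (c′ * a) * (c * c′))
    ≡ ((a + c) * ((a + c) * 1)) * (a′ * (a′ * 1) + c′ * (c′ * 1))
  collect = solve-∀

D-positive : ∀ x .(x≢𝟎 : x ≢ 𝟎) → ℚ.Positive (D x x≢𝟎)
D-positive x@(suc _ , _)     x≢𝟎 = ℚ.normalize-pos (‖ x ‖₁ ^ 2) ‖ x ‖₂² 
D-positive x@(zero , suc _)  x≢𝟎 = ℚ.normalize-pos (‖ x ‖₁ ^ 2) ‖ x ‖₂² 
D-positive (zero , zero)     x≢𝟎 = ⊥-elim-irr (x≢𝟎 refl)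

-- Optimality of the partition

module Optimality {b₁ b₂ i c : ℕ} .{{_ : NonZero b₁}} (b₁≤b₂ : b₁ ≤ b₂) (b₁⊥b₂ : Coprime b₁ b₂)
                  (2≤b₁ : 2 ≤ b₁) (1≤i : 1 ≤ i) (i<b₁ : i < b₁) (det : c * b₁ ≡ suc (b₂ * i)) where

  b x x′ : ℤ₊²
  b  = b₁ , b₂
  x  = i , c
  x′ = b ⊖ x

  i′ = b₁ ∸ i
  c′ = b₂ ∸ c

  i<c : i < c
  i<c = *-cancelʳ-< b₁ i c
    (≤-trans (s≤s (≤-trans (≤-reflexive (*-comm i b₁)) (*-monoˡ-≤ i b₁≤b₂))) (≤-reflexive (sym det)))

  -- Ensures that `b ⊖ x` does not truncate its second coordinate.
  c≤b₂ : c ≤ b₂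
  c≤b₂ = *-cancelʳ-≤ c b₂ b₁ (begin
    c * b₁         ≡⟨ det ⟩
    1 + b₂ * i     ≤⟨ +-monoˡ-≤ (b₂ * i) (≤-trans (≤-trans (n≤1+n 1) 2≤b₁) b₁≤b₂) ⟩
    b₂ + b₂ * i    ≡⟨ *-suc b₂ i ⟨
    b₂ * suc i     ≤⟨ *-monoʳ-≤ b₂ i<b₁ ⟩
    b₂ * b₁        ∎)
    where open ≤-Reasoning

  i+i′≡b₁ : i + i′ ≡ b₁
  i+i′≡b₁ = m+[n∸m]≡n (<⇒≤ i<b₁)

  c+c′≡b₂ : c + c′ ≡ b₂
  c+c′≡b₂ = m+[n∸m]≡n c≤b₂

  -- Subtracting `x` from `b` does not change the determinant with `x`, so `x` is steeper than `x′`.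
  det′ : c * i′ ≡ suc (c′ * i)
  det′ = +-cancelˡ-≡ (c * i) _ _ (begin
    c * i + c * i′          ≡⟨ *-distribˡ-+ c i i′ ⟨
    c * (i + i′)            ≡⟨ cong (c *_) i+i′≡b₁ ⟩
    c * b₁                  ≡⟨ det ⟩
    suc (b₂ * i)            ≡⟨ cong (λ n → suc (n * i)) c+c′≡b₂ ⟨
    suc ((c + c′) * i)      ≡⟨ cong suc (*-distribʳ-+ i c c′) ⟩
    suc (c * i + c′ * i)    ≡⟨ +-suc (c * i) (c′ * i) ⟨
    c * i + suc (c′ * i)    ∎)
    where open ≡-Reasoning

  -- If `i′ > c′`, then `c * i′` is at least `(i + 1) * (c′ + 1)`, which exceeds `c′ * i + 1`
  -- because `i ≥ 1`; this contradicts `det′`.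
  i′≤c′ : i′ ≤ c′
  i′≤c′ with i′ ≤? c′
  ... | yes i′≤c′ = i′≤c′
  ... | no  i′≰c′ = contradiction (begin
    suc (suc (c′ * i))             ≤⟨ s≤s (≤-trans (+-monoˡ-≤ (c′ * i) (≤-trans 1≤i (m≤m+n i c′)))
                                                (≤-reflexive (lemma i c′))) ⟩
    suc (c′ + i * suc c′)          ≤⟨ *-mono-≤ i<c (≰⇒> i′≰c′) ⟩
    c * i′                         ≡⟨ det′ ⟩
    suc (c′ * i)                   ∎) 1+n≰n
    where
    open ≤-Reasoning
    lemma : ∀ i c′ → i + c′ + c′ * i ≡ c′ + i * suc c′
    lemma = solve-∀

  x≢𝟎 : x ≢ 𝟎
  x≢𝟎 x≡𝟎 = <⇒≢ 1≤i (sym (cong proj₁ x≡𝟎))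

  x′≢𝟎 : x′ ≢ 𝟎
  x′≢𝟎 x′≡𝟎 = <⇒≢ (m<n⇒0<n∸m i<b₁) (sym (cong proj₁ x′≡𝟎))

  partition : IsPartition b x x′
  partition = record { x₁≢𝟎 = x≢𝟎 ; x₂≢𝟎 = x′≢𝟎 ; sum≡ = cong₂ _,_ i+i′≡b₁ c+c′≡b₂ }

  b≢𝟎 : b ≢ 𝟎
  b≢𝟎 = IsPartition.b≢𝟎 partition

  Dx≤Dx′ : D x x≢𝟎 ℚ.≤ D x′ x′≢𝟎
  Dx≤Dx′ = D-antitone x′ x x′≢𝟎 x≢𝟎 i′≤c′ (<⇒≤ i<c) (≤-trans (n≤1+n _) (≤-reflexive (sym det′)))

  -- Gives `0 ≤ ε` for the `ε` chosen below.
  Dx≤Db : D x x≢𝟎 ℚ.≤ D b b≢𝟎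
  Dx≤Db = D-antitone b x b≢𝟎 x≢𝟎 b₁≤b₂ (<⇒≤ i<c) (≤-trans (n≤1+n _) (≤-reflexive (sym det)))

  -- The determinants det (b , y) and det (b , x) = 1 give
  -- b₁ det (x , y) = i det (b , y) - y₁ > - b₁.
  steep⇒⊒x : ∀ {y} → proj₁ y ≤ b₁ → b₂ * proj₁ y < proj₂ y * b₁ → y ⊒ x
  steep⇒⊒x {a , e} a≤b₁ b₂a<eb₁ with c * a ≤? e * i
  ... | yes ca≤ei = ca≤ei
  ... | no  ca≰ei = contradiction (begin
    suc (b₂ * i * a + b₁)      ≤⟨ +-monoˡ-≤ b₁ (m<m+n (b₂ * i * a) 1≤i) ⟩
    b₂ * i * a + i + b₁        ≡⟨ lemma b₁ b₂ i a ⟩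
    suc (b₂ * a) * i + b₁      ≤⟨ +-monoˡ-≤ b₁ (*-monoˡ-≤ i b₂a<eb₁) ⟩
    e * b₁ * i + b₁            ≡⟨ lemma₂ b₁ e i ⟩
    suc (e * i) * b₁           ≤⟨ *-monoˡ-≤ b₁ (≰⇒> ca≰ei) ⟩
    c * a * b₁                 ≡⟨ lemma₃ b₁ c a ⟩
    c * b₁ * a                 ≡⟨ cong (_* a) det ⟩
    a + b₂ * i * a             ≤⟨ +-monoˡ-≤ (b₂ * i * a) a≤b₁ ⟩
    b₁ + b₂ * i * a            ≡⟨ +-comm b₁ _ ⟩
    b₂ * i * a + b₁            ∎) 1+n≰n
    where
    open ≤-Reasoning
    lemma : ∀ b₁ b₂ i a → b₂ * i * a + i + b₁ ≡ suc (b₂ * a) * i + b₁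
    lemma = solve-∀
    lemma₂ : ∀ b₁ e i → e * b₁ * i + b₁ ≡ suc (e * i) * b₁
    lemma₂ = solve-∀
    lemma₃ : ∀ b₁ c a → c * a * b₁ ≡ c * b₁ * a
    lemma₃ = solve-∀

  ⊒x⇒D≤ : ∀ {y} (y≢𝟎 : y ≢ 𝟎) → y ⊒ x → D y y≢𝟎 ℚ.≤ D x x≢𝟎
  ⊒x⇒D≤ {a , e} y≢𝟎 y⊒x = D-antitone x (a , e) x≢𝟎 y≢𝟎 (<⇒≤ i<c)
    -- At least as steep as `x`, `y` is above the diagonal too: `a * i ≤ c * a ≤ e * i`.
    (*-cancelʳ-≤ a e i {{>-nonZero 1≤i}}
      (≤-trans (≤-trans (≤-reflexive (*-comm a i)) (*-monoˡ-≤ a (<⇒≤ i<c))) y⊒x)) y⊒x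

  -- The cases are the signs of det (b , y). It is the negative of det (b , z), so unless it
  -- vanishes one part is strictly above the line through `b`. If it vanishes, `b₁` divides `a`, so
  -- `a` is 0 or `b₁` and one part is zero.
  minD≤Dx : ∀ {y z} (q : IsPartition b y z) → minD q ℚ.≤ D x x≢𝟎
  minD≤Dx {y@(a , e)} {z@(a′ , e′)} q with <-cmp (b₂ * a) (e * b₁)
  ... | tri< b₂a<eb₁ _ _ =
    ℚ.≤-trans (ℚ.p⊓q≤p _ _) (⊒x⇒D≤ {y} (IsPartition.x₁≢𝟎 q) (steep⇒⊒x {y} a≤b₁ b₂a<eb₁))
    where
    a≤b₁ : a ≤ b₁
    a≤b₁ = ≤-trans (m≤m+n a a′) (≤-reflexive (cong proj₁ (IsPartition.sum≡ q)))
  ... | tri> _ _ eb₁<b₂a =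
    ℚ.≤-trans (ℚ.p⊓q≤q (D y (IsPartition.x₁≢𝟎 q)) _)
      (⊒x⇒D≤ {z} (IsPartition.x₂≢𝟎 q) (steep⇒⊒x {z} a′≤b₁ b₂a′<e′b₁))
    where
    open ≤-Reasoning
    a+a′≡b₁ = cong proj₁ (IsPartition.sum≡ q)
    e+e′≡b₂ = cong proj₂ (IsPartition.sum≡ q)
    a′≤b₁ : a′ ≤ b₁
    a′≤b₁ = ≤-trans (m≤n+m a′ a) (≤-reflexive a+a′≡b₁)
    b₂a′<e′b₁ : b₂ * a′ < e′ * b₁
    b₂a′<e′b₁ = +-cancelˡ-< (e * b₁) _ _ (begin-strict
      e * b₁ + b₂ * a′    <⟨ +-monoˡ-< (b₂ * a′) eb₁<b₂a ⟩
      b₂ * a + b₂ * a′    ≡⟨ *-distribˡ-+ b₂ a a′ ⟨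
      b₂ * (a + a′)       ≡⟨ cong₂ _*_ (sym e+e′≡b₂) a+a′≡b₁ ⟩
      (e + e′) * b₁       ≡⟨ *-distribʳ-+ b₁ e e′ ⟩
      e * b₁ + e′ * b₁    ∎)
  ... | tri≈ _ b₂a≡eb₁ _ = parallel
    where
    a+a′≡b₁ = cong proj₁ (IsPartition.sum≡ q)
    e+e′≡b₂ = cong proj₂ (IsPartition.sum≡ q)
    b₁∣a : b₁ ∣ a
    b₁∣a = coprime-divisor b₁⊥b₂ (divides e b₂a≡eb₁)
    parallel : minD q ℚ.≤ D x x≢𝟎
    parallel with a ≟ 0
    ... | yes refl = contradiction (cong (0 ,_) e≡0) (IsPartition.x₁≢𝟎 q)
      where
      e≡0 : e ≡ 0
      e≡0 = m*n≡0⇒m≡0 e b₁ (trans (sym b₂a≡eb₁) (*-zeroʳ b₂))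
    ... | no a≢0 = contradiction (cong₂ _,_ a′≡0 e′≡0) (IsPartition.x₂≢𝟎 q)
      where
      a≡b₁ : a ≡ b₁
      a≡b₁ = ≤-antisym (≤-trans (m≤m+n a a′) (≤-reflexive a+a′≡b₁)) (∣⇒≤ {{≢-nonZero a≢0}} b₁∣a)
      a′≡0 : a′ ≡ 0
      a′≡0 = +-cancelˡ-≡ a _ _ (trans a+a′≡b₁ (trans (sym a≡b₁) (sym (+-identityʳ a))))
      b₂≡e : b₂ ≡ e
      b₂≡e = *-cancelʳ-≡ b₂ e b₁ (trans (cong (b₂ *_) (sym a≡b₁)) b₂a≡eb₁)
      e′≡0 : e′ ≡ 0
      e′≡0 = +-cancelˡ-≡ e _ _ (trans e+e′≡b₂ (trans b₂≡e (sym (+-identityʳ e))))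

  maximizesMinD : MaximizesMinD b x x′
  maximizesMinD = partition , λ q → subst (minD q ℚ.≤_) (sym (ℚ.p≤q⇒p⊓q≡p Dx≤Dx′)) (minD≤Dx q)

  solves : Solves b x x′
  solves = ε , ((0≤ε , x , x′ , feasible) , minimal) , feasible
    where
    Db = D b b≢𝟎
    Dx = D x x≢𝟎
    instance
      Db>0 : ℚ.Positive Db
      Db>0 = D-positive b b≢𝟎
      Db≢0 : ℚ.NonZero Db
      Db≢0 = ℚ.pos⇒nonZero Db
    ε : ℚ
    -- Chosen so that the constraint on `x`, the part of smaller diversity, is an equality.
    ε = 1ℚ ℚ.- Dx ℚ.* 1/ Db
    1-ε : (1ℚ ℚ.- ε) ℚ.* Db ≡ Dx
    1-ε = begin
      (1ℚ ℚ.- (1ℚ ℚ.- Dx ℚ.* 1/ Db)) ℚ.* Db ≡⟨ lemma Dx (1/ Db) Db ⟩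
      Dx ℚ.* (1/ Db ℚ.* Db)                 ≡⟨ cong (Dx ℚ.*_) (ℚ.*-inverseˡ Db) ⟩
      Dx ℚ.* 1ℚ                             ≡⟨ ℚ.*-identityʳ Dx ⟩
      Dx                                    ∎
      where
      open ≡-Reasoning
      open ℚ-Solver.+-*-Solver
      lemma : ∀ p r d → (1ℚ ℚ.- (1ℚ ℚ.- p ℚ.* r)) ℚ.* d ≡ p ℚ.* (r ℚ.* d)
      lemma = solve 3 (λ p r d → (con 1ℚ :- (con 1ℚ :- p :* r)) :* d := p :* (r :* d)) refl
    feasible : Feasible b ε x x′
    feasible = partition , ℚ.≤-reflexive 1-ε , ℚ.≤-trans (ℚ.≤-reflexive 1-ε) Dx≤Dx′
    complement-cancel-≤ : ∀ {δ ε} → (1ℚ ℚ.- δ) ℚ.* Db ℚ.≤ (1ℚ ℚ.- ε) ℚ.* Db → ε ℚ.≤ δ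
    complement-cancel-≤ {δ} {ε} le = begin
      ε                              ≡⟨ lemma ε δ ⟩
      (1ℚ ℚ.- δ) ℚ.+ (ε ℚ.+ δ ℚ.- 1ℚ)
        ≤⟨ ℚ.+-monoˡ-≤ (ε ℚ.+ δ ℚ.- 1ℚ) (ℚ.*-cancelʳ-≤-pos {1ℚ ℚ.- δ} {1ℚ ℚ.- ε} Db le) ⟩
      (1ℚ ℚ.- ε) ℚ.+ (ε ℚ.+ δ ℚ.- 1ℚ)   ≡⟨ lemma₂ ε δ ⟩
      δ                              ∎
      where
      open ℚ.≤-Reasoning
      open ℚ-Solver.+-*-Solver
      lemma : ∀ ε δ → ε ≡ (1ℚ ℚ.- δ) ℚ.+ (ε ℚ.+ δ ℚ.- 1ℚ)
      lemma = solve 2 (λ ε δ → ε := (con 1ℚ :- δ) :+ (ε :+ δ :- con 1ℚ)) refl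
      lemma₂ : ∀ ε δ → (1ℚ ℚ.- ε) ℚ.+ (ε ℚ.+ δ ℚ.- 1ℚ) ≡ δ
      lemma₂ = solve 2 (λ ε δ → (con 1ℚ :- ε) :+ (ε :+ δ :- con 1ℚ) := δ) refl
    0≤ε : 0ℚ ℚ.≤ ε
    0≤ε = complement-cancel-≤ (ℚ.≤-trans (ℚ.≤-reflexive 1-ε)
      (ℚ.≤-trans Dx≤Db (ℚ.≤-reflexive (sym (ℚ.*-identityˡ Db)))))
    minimal : ∀ ε′ → Attainable b ε′ → ε ℚ.≤ ε′
    minimal ε′ (_ , y , z , q , ≤Dy , ≤Dz) =
      complement-cancel-≤ {ε′} {ε} (ℚ.≤-trans (ℚ.⊓-glb ≤Dy ≤Dz)
        (ℚ.≤-trans (minD≤Dx q) (ℚ.≤-reflexive (sym 1-ε))))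

-- Running time

negMod-cost : ∀ t m → cost (negMod t m) ≤ bits m + bits ∣ t ∣
negMod-cost (ℤ.+ n)    m = ≤-refl
negMod-cost ℤ.-[1+ n ] m = z≤n

-- The crude count of `bits M` rounds is good enough for a division performed only once.
divMod-cost-bits : ∀ a b M → 1 ≤ b → b ≤ M → a ≤ M →
                   cost (divMod a b) ≤ 3 * bits M + bits M * (13 * bits M)
divMod-cost-bits a b M 1≤b b≤M a≤M = divMod-cost a b M (bits M) 1≤b b≤M a≤M
  (<-≤-trans (≤-<-trans a≤M (n<2^[1+⌊log₂n⌋] M)) (m≤m*n (2 ^ bits M) b {{>-nonZero 1≤b}}))

ceilDiv-cost : ∀ a b M → 1 ≤ b → b ≤ M → a ≤ M →
               cost (ceilDiv a b) ≤ 3 * bits M + bits M * (13 * bits M) + (2 * bits M + 2 * bits M)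
ceilDiv-cost a b M 1≤b b≤M a≤M =
  +-mono-≤ (divMod-cost-bits a b M 1≤b b≤M a≤M)
    (+-mono-≤ (pair (bits-mono-≤ r≤M) 1≤B)
      (cost-if (r <ᵇ 1) {return q} {add q 1} z≤n (pair (bits-mono-≤ q≤M) 1≤B)))
  where
  q = proj₁ (value (divMod a b))
  r = proj₂ (value (divMod a b))
  qb+r≡a = divMod-sum a b
  r≤M = ≤-trans (m≤n+m r (q * b)) (≤-trans (≤-reflexive qb+r≡a) a≤M)
  q≤M = ≤-trans (≤-trans (m≤m*n q b {{>-nonZero 1≤b}}) (m≤m+n (q * b) r)) (≤-trans (≤-reflexive qb+r≡a) a≤M)
  1≤B : 1 ≤ bits M
  1≤B = s≤s z≤n
  pair : ∀ {m n B} → m ≤ B → n ≤ B → m + n ≤ 2 * B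
  pair {B = B} m≤B n≤B = ≤-trans (+-mono-≤ m≤B n≤B) (≤-reflexive (cong (B +_) (sym (+-identityʳ B))))

computei*-cost : ∀ b₁ b₂ → 1 ≤ b₁ → b₁ ≤ b₂ → Coprime b₁ b₂ → let N = bits b₂ in
                 cost (computei* b₁ b₂) ≤ 3 * N + N * (13 * N) + (2 + 49 * N * (N + N) + (N + N))
computei*-cost b₁ b₂ 1≤b₁ b₁≤b₂ b₁⊥b₂ =
  +-mono-≤ (divMod-cost-bits b₂ b₁ b₂ 1≤b₁ b₁≤b₂ ≤-refl)
    (+-mono-≤ (≤-trans (egcd′-cost (suc τ) b₁ τ b₂ τ<b₁ (n<1+n τ) b₁≤b₂ b₁⊥τ)
                 (+-monoʳ-≤ 2 (*-monoʳ-≤ (49 * bits b₂)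
                   (+-mono-≤ (log≤N b₁≤b₂) (log≤N (≤-trans (<⇒≤ τ<b₁) b₁≤b₂))))))
              (≤-trans (negMod-cost t b₁)
                (+-mono-≤ (bits-mono-≤ b₁≤b₂) (bits-mono-≤ (≤-trans ∣t∣≤b₁ b₁≤b₂)))))
  where
  τ = proj₂ (value (divMod b₂ b₁))
  τ<b₁ : τ < b₁
  τ<b₁ = divMod-rem b₂ b₁ 1≤b₁
  b₁⊥τ : Coprime b₁ τ
  b₁⊥τ = coprime-step {q = proj₁ (value (divMod b₂ b₁))} (divMod-sum b₂ b₁) (Coprime.sym b₁⊥b₂)
  t = proj₂ (value (egcd b₁ τ))
  ∣t∣≤b₁ : ∣ t ∣ ≤ b₁
  ∣t∣≤b₁ = proj₂ (egcd′-bounded (suc τ) b₁ τ τ<b₁ (n<1+n τ) b₁⊥τ)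
  log≤N : ∀ {m} → m ≤ b₂ → ⌊log₂ m ⌋ ≤ bits b₂
  log≤N m≤b₂ = ≤-trans (n≤1+n _) (bits-mono-≤ m≤b₂)

-- The product `b₂ * i` is measured against `b₂ * b₂`, whose bit length is at most `N + N`. As
-- `N ≥ 1`, the coefficients 177, 23 and 4 of the quadratic bound add up to 204.
computePartition-cost : ∀ b₁ b₂ → 2 ≤ b₁ → b₁ ≤ b₂ → Coprime b₁ b₂ →
                        cost (computePartition (b₁ , b₂)) ≤ 204 * (bits b₂ * bits b₂)
computePartition-cost b₁ b₂ 2≤b₁ b₁≤b₂ b₁⊥b₂ = begin
  _ ≤⟨ +-mono-≤ (computei*-cost b₁ b₂ 1≤b₁ b₁≤b₂ b₁⊥b₂) (+-mono-≤ cost-mul (+-mono-≤ cost-ceilDiv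
         (+-mono-≤ (+-mono-≤ (bits-mono-≤ b₁≤b₂) (bits-mono-≤ i≤b₂))
           (+-monoˡ-≤ 0 (+-mono-≤ (≤-refl {N}) (bits-mono-≤ c≤b₂)))))) ⟩
  3 * N + N * (13 * N) + (2 + 49 * N * (N + N) + (N + N)) + (2 + N * (7 * (N + N))
    + (3 * (N + N) + (N + N) * (13 * (N + N)) + (2 * (N + N) + 2 * (N + N)) + (N + N + (N + N + 0))))
    ≡⟨ lemma N ⟩
  177 * (N * N) + 23 * (1 * N) + 4 * (1 * 1)
    ≤⟨ +-mono-≤ (+-monoʳ-≤ (177 * (N * N)) (*-monoʳ-≤ 23 (*-monoˡ-≤ N 1≤N)))
                (*-monoʳ-≤ 4 (*-mono-≤ 1≤N 1≤N)) ⟩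
  177 * (N * N) + 23 * (N * N) + 4 * (N * N) ≡⟨ lemma₂ (N * N) ⟩
  204 * (N * N) ∎
  where
  open ≤-Reasoning
  N = bits b₂
  i = value (computei* b₁ b₂)
  p = value (mul b₂ i)
  c = value (ceilDiv p b₁)
  1≤N : 1 ≤ N
  1≤N = s≤s z≤n
  1≤b₁ : 1 ≤ b₁
  1≤b₁ = ≤-trans (n≤1+n 1) 2≤b₁
  instance
    b₁≢0 : NonZero b₁
    b₁≢0 = >-nonZero 1≤b₁
    b₂≢0 : NonZero b₂
    b₂≢0 = >-nonZero (≤-trans 1≤b₁ b₁≤b₂)
  i<b₁ : i < b₁
  i<b₁ = Isi*-< {b₁} {b₂} {i} (computei*-Isi* b₁ b₂ 2≤b₁ b₁⊥b₂)
  i≤b₂ = ≤-trans (<⇒≤ i<b₁) b₁≤b₂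
  M = b₂ * b₂
  b₂≤M : b₂ ≤ M
  b₂≤M = m≤m*n b₂ b₂
  bits-M : bits M ≤ N + N
  bits-M = s≤s (≤-trans (⌊log₂mn⌋≤ b₂ b₂) (≤-reflexive (sym (+-suc ⌊log₂ b₂ ⌋ ⌊log₂ b₂ ⌋))))
  b₂i≤M : b₂ * i ≤ M
  b₂i≤M = *-monoʳ-≤ b₂ i≤b₂
  cost-mul : cost (mul b₂ i) ≤ 2 + N * (7 * (N + N))
  cost-mul = ≤-trans (mul-cost b₂ i M N (n<2^[1+⌊log₂n⌋] b₂) b₂≤M (≤-trans i≤b₂ b₂≤M) b₂i≤M)
                     (+-monoʳ-≤ 2 (*-monoʳ-≤ N (*-monoʳ-≤ 7 bits-M)))
  p≡b₂i : p ≡ b₂ * i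
  p≡b₂i = mul-value b₂ i
  cost-ceilDiv : cost (ceilDiv p b₁) ≤ 3 * (N + N) + (N + N) * (13 * (N + N)) + (2 * (N + N) + 2 * (N + N))
  cost-ceilDiv = ≤-trans (ceilDiv-cost p b₁ M 1≤b₁ (≤-trans b₁≤b₂ b₂≤M) (≤-trans (≤-reflexive p≡b₂i) b₂i≤M))
    (+-mono-≤ (+-mono-≤ (*-monoʳ-≤ 3 bits-M) (*-mono-≤ bits-M (*-monoʳ-≤ 13 bits-M)))
              (+-mono-≤ (*-monoʳ-≤ 2 bits-M) (*-monoʳ-≤ 2 bits-M)))
  c≤b₂ : c ≤ b₂
  c≤b₂ = *-cancelʳ-≤ c b₂ b₁ (begin
    c * b₁         ≤⟨ <⇒≤ (proj₂ (ceilDiv-spec p b₁ 1≤b₁)) ⟩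
    p + b₁         ≡⟨ cong (_+ b₁) p≡b₂i ⟩
    b₂ * i + b₁    ≤⟨ +-monoʳ-≤ (b₂ * i) b₁≤b₂ ⟩
    b₂ * i + b₂    ≡⟨ trans (+-comm (b₂ * i) b₂) (sym (*-suc b₂ i)) ⟩
    b₂ * suc i     ≤⟨ *-monoʳ-≤ b₂ i<b₁ ⟩
    b₂ * b₁        ∎)
  lemma : ∀ N → 3 * N + N * (13 * N) + (2 + 49 * N * (N + N) + (N + N)) + (2 + N * (7 * (N + N))
    + (3 * (N + N) + (N + N) * (13 * (N + N)) + (2 * (N + N) + 2 * (N + N)) + (N + N + (N + N + 0))))
    ≡ 177 * (N * N) + 23 * (1 * N) + 4 * (1 * 1)
  lemma = solve-∀
  lemma₂ : ∀ s → 177 * s + 23 * s + 4 * s ≡ 204 * s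
  lemma₂ = solve-∀

theorem3 : (∀ (b₁ b₂ : ℕ) .{{_ : NonZero b₁}} → 2 ≤ b₁ → b₁ ≤ b₂ → gcd b₁ b₂ ≡ 1 →
    let b = (b₁ , b₂) in
    (∃[ i* ] Isi* b₁ b₂ i*) ×
    (∀ i* → Isi* b₁ b₂ i* →
    let x = part b₁ b₂ i* in
    Solves b x (b ⊖ x) ×
    MaximizesMinD b x (b ⊖ x) ×
    (value (computePartition b) ≡ (x , b ⊖ x))))
    ×
    (Σ[ C ∈ ℕ ] (∀ (b₁ b₂ : ℕ) → 2 ≤ b₁ → b₁ ≤ b₂ → gcd b₁ b₂ ≡ 1 →
    cost (computePartition (b₁ , b₂)) ≤ C * ⌊log₂ (b₁ ⊔ b₂) ⌋ ^ 2))
theorem3 = optimal , 816 , fast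
  where
  optimal : ∀ (b₁ b₂ : ℕ) .{{_ : NonZero b₁}} → 2 ≤ b₁ → b₁ ≤ b₂ → gcd b₁ b₂ ≡ 1 →
    let b = (b₁ , b₂) in
    (∃[ i* ] Isi* b₁ b₂ i*) ×
    (∀ i* → Isi* b₁ b₂ i* →
    let x = part b₁ b₂ i* in
    Solves b x (b ⊖ x) ×
    MaximizesMinD b x (b ⊖ x) ×
    (value (computePartition b) ≡ (x , b ⊖ x)))
  optimal b₁ b₂ 2≤b₁ b₁≤b₂ gcd≡1 = (value (computei* b₁ b₂) , computei*-Isi* b₁ b₂ 2≤b₁ b₁⊥b₂) , λ i I →
    let c , det = i*-determinant b₁ b₂ {i} I
        open Optimality {c = c} b₁≤b₂ b₁⊥b₂ 2≤b₁ (proj₁ I) (Isi*-< {b₁} {b₂} {i} I) det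
        x≡part = sym (part-≡ b₁ b₂ 2≤b₁ det)
    in subst (λ x → Solves (b₁ , b₂) x ((b₁ , b₂) ⊖ x)) x≡part solves
     , subst (λ x → MaximizesMinD (b₁ , b₂) x ((b₁ , b₂) ⊖ x)) x≡part maximizesMinD
     , computePartition-value b₁ b₂ i 2≤b₁ b₁⊥b₂ I
    where
    b₁⊥b₂ : Coprime b₁ b₂
    b₁⊥b₂ = gcd≡1⇒coprime gcd≡1

  fast : ∀ (b₁ b₂ : ℕ) → 2 ≤ b₁ → b₁ ≤ b₂ → gcd b₁ b₂ ≡ 1 →
    cost (computePartition (b₁ , b₂)) ≤ 816 * ⌊log₂ (b₁ ⊔ b₂) ⌋ ^ 2
  fast b₁ b₂ 2≤b₁ b₁≤b₂ gcd≡1 = begin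
    cost (computePartition (b₁ , b₂)) ≤⟨ computePartition-cost b₁ b₂ 2≤b₁ b₁≤b₂ (gcd≡1⇒coprime gcd≡1) ⟩
    204 * (suc l * suc l)             ≤⟨ *-monoʳ-≤ 204 (*-mono-≤ 1+l≤2l 1+l≤2l) ⟩
    204 * ((l + l) * (l + l))         ≡⟨ lemma l ⟩
    816 * (l * (l * 1))               ≡⟨ cong (λ n → 816 * ⌊log₂ n ⌋ ^ 2) (m≤n⇒m⊔n≡n b₁≤b₂) ⟨
    816 * ⌊log₂ (b₁ ⊔ b₂) ⌋ ^ 2       ∎
    where
    open ≤-Reasoning
    l = ⌊log₂ b₂ ⌋
    1+l≤2l : suc l ≤ l + l
    -- Since `b₂ ≥ 2`, `l` is at least 1, so the bit length is at most twice the logarithm; squaring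
    -- turns 204 into 816.
    1+l≤2l = +-monoˡ-≤ l (⌊log₂⌋-mono-≤ (≤-trans 2≤b₁ b₁≤b₂))
    lemma : ∀ l → 204 * ((l + l) * (l + l)) ≡ 816 * (l * (l * 1))
    lemma = solve-∀
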